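{- There is a constant $\alpha>0$ such that, given an instance $I=(G,k,c)$ of Multicolored Clique, one can in polynomial time construct a universe $U$, a family $\mathcal{F}\subseteq 2^U$ of sets each of size exactly $3$, and a subfamily $\mathcal{F}_0\subseteq\mathcal{F}$ of pairwise disjoint sets with $|\mathcal{F}_0|=|U|/3-1$, such that: (1) if $I$ is a YES-instance, then there exists a family $\mathcal{F}_1\subseteq\mathcal{F}$ of $|U|/3$ pairwise disjoint sets with $|\mathcal{F}_0\setminus\mathcal{F}_1|+|\mathcal{F}_1\setminus\mathcal{F}_0|\le\alpha k^2$; (2) if there exists a subfamily $\mathcal{F}_1\subseteq\mathcal{F}$ of $|U|/3$ pairwise disjoint sets, then $I$ is a YES-instance.
   Context: Multicolored Clique: given an undirected graph $G=(V,E)$, a positive integer $k$, and a coloring $c:V\to\{0,\dots,k-1\}$, decide whether $G$ contains a clique of size $k$ whose vertices have pairwise distinct colors. It is a YES-instance if such a clique exists. -}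

module Defs where

open import Data.Bool using (Bool; true; false; T)
open import Data.Fin using (Fin; toℕ)
open import Data.Fin.Subset using (Subset; _∈_; _∩_; ∣_∣; Empty)
open import Data.List using (List; []; _∷_; replicate)
open import Data.Nat using (ℕ; suc; _+_; _*_; _^_; _≤_; _>_; _/_)
open import Data.Nat.Binary using (ℕᵇ; zero; 2[1+_]; 1+[2_]; fromℕ)
open import Data.Nat.Divisibility using (_∣_)
open import Data.Product using (_×_; ∃-syntax)
open import Data.Vec using (Vec; lookup; tabulate; toList)
open import Function.Definitions using (Injective)
open import Relation.Binary.PropositionalEquality using (_≡_; _≢_)

------------------------------------------------------------------------
-- Polynomial time
--
-- The machine model is a while language over binary trees, in the style
-- of Jones' WHILE.  A program transforms the tree held in a single
-- register.  Every step is charged the size of the register's content,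
-- and `cons` pays for both subcomputations, so the running time bounds
-- the size of every tree produced.  Hence a Turing machine working on
-- linear tree descriptions simulates a program with polynomial overhead,
-- and conversely (two stacks hold a tape).

data Tree : Set where
  nil  : Tree
  node : Tree → Tree → Tree

size : Tree → ℕ
size nil        = 1
size (node x y) = suc (size x + size y)

infixr 5 _⨾_

data Prog : Set where
  skip  : Prog
  empty : Prog
  hd tl : Prog
  cons  : Prog → Prog → Prog
  _⨾_   : Prog → Prog → Prog
  cond  : (test yes no : Prog) → Prog
  while : (test body : Prog) → Prog

-- p ⊢ x ⇓ y [ t ]: started on x, the program p halts with y in time t.
-- A test succeeds when its value is not nil; its value is then discarded.

infix 4 _⊢_⇓_[_]

data _⊢_⇓_[_] : Prog → Tree → Tree → ℕ → Set where
  skip⇓      : ∀ {x} → skip ⊢ x ⇓ x [ size x ]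
  empty⇓     : ∀ {x} → empty ⊢ x ⇓ nil [ size x ]
  hd-nil⇓    : hd ⊢ nil ⇓ nil [ 1 ]
  hd-node⇓   : ∀ {x y} → hd ⊢ node x y ⇓ x [ size (node x y) ]
  tl-nil⇓    : tl ⊢ nil ⇓ nil [ 1 ]
  tl-node⇓   : ∀ {x y} → tl ⊢ node x y ⇓ y [ size (node x y) ]
  cons⇓      : ∀ {p q x y z s t} →
               p ⊢ x ⇓ y [ s ] → q ⊢ x ⇓ z [ t ] →
               cons p q ⊢ x ⇓ node y z [ size x + (s + t) ]
  seq⇓       : ∀ {p q x y z s t} →
               p ⊢ x ⇓ y [ s ] → q ⊢ y ⇓ z [ t ] →
               p ⨾ q ⊢ x ⇓ z [ size x + (s + t) ]
  cond-yes⇓  : ∀ {b p q x u v y s t} →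
               b ⊢ x ⇓ node u v [ s ] → p ⊢ x ⇓ y [ t ] →
               cond b p q ⊢ x ⇓ y [ size x + (s + t) ]
  cond-no⇓   : ∀ {b p q x y s t} →
               b ⊢ x ⇓ nil [ s ] → q ⊢ x ⇓ y [ t ] →
               cond b p q ⊢ x ⇓ y [ size x + (s + t) ]
  while-yes⇓ : ∀ {b p x u v y z r s t} →
               b ⊢ x ⇓ node u v [ r ] → p ⊢ x ⇓ y [ s ] →
               while b p ⊢ y ⇓ z [ t ] →
               while b p ⊢ x ⇓ z [ size x + (r + (s + t)) ]
  while-no⇓  : ∀ {b p x s} →
               b ⊢ x ⇓ nil [ s ] →
               while b p ⊢ x ⇓ x [ size x + s ]

-- As size x ≥ 1, the bounds c * size x ^ d dominate every polynomial.

PolyTime : {A B : Set} → (A → Tree) → (B → Tree) → (A → B) → Set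
PolyTime encA encB f =
  ∃[ p ] ∃[ c ] ∃[ d ] (∀ a → ∃[ t ]
    (p ⊢ encA a ⇓ encB (f a) [ t ] × t ≤ c * size (encA a) ^ d))

encBool : Bool → Tree
encBool false = nil
encBool true  = node nil nil

encList : {A : Set} → (A → Tree) → List A → Tree
encList enc []       = nil
encList enc (x ∷ xs) = node (enc x) (encList enc xs)

encVec : {A : Set} {n : ℕ} → (A → Tree) → Vec A n → Tree
encVec enc xs = encList enc (toList xs)

encℕᵇ : ℕᵇ → Tree
encℕᵇ zero     = nil
encℕᵇ 2[1+ b ] = node (encBool false) (encℕᵇ b)
encℕᵇ 1+[2 b ] = node (encBool true) (encℕᵇ b)

encBinary : ℕ → Tree
encBinary n = encℕᵇ (fromℕ n)

encUnary : ℕ → Tree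
encUnary n = encList encBool (replicate n false)

------------------------------------------------------------------------
-- Multicolored Clique

record Instance : Set where
  field
    n     : ℕ
    adj   : Fin n → Fin n → Bool
    sym   : ∀ u v → adj u v ≡ adj v u
    irr   : ∀ v → adj v v ≡ false
    k     : ℕ
    k>0   : k > 0
    color : Fin n → Fin k

record IsMulticoloredClique (I : Instance) (K : Subset (Instance.n I)) : Set where
  open Instance I
  field
    card     : ∣ K ∣ ≡ k
    clique   : ∀ {u v} → u ∈ K → v ∈ K → u ≢ v → T (adj u v)
    distinct : ∀ {u v} → u ∈ K → v ∈ K → u ≢ v → color u ≢ color v

Yes : Instance → Set
Yes I = ∃[ K ] IsMulticoloredClique I K

-- k and the colors in binary, and the adjacency matrix by rows.

encInstance : Instance → Tree
encInstance I =
  node (encBinary k)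
    (node (encVec (λ x → encBinary (toℕ x)) (tabulate color))
          (encVec (encVec encBool) (tabulate λ u → tabulate (adj u))))
  where open Instance I

------------------------------------------------------------------------
-- Set families
--
-- The universe is Fin m.  The family 𝓕 is enumerated without repetition
-- (see IsValid), so subfamilies are exactly the subsets of the indices
-- Fin N, with the same cardinalities and differences.

record SetSystem : Set where
  field
    m  : ℕ
    N  : ℕ
    𝓕  : Vec (Subset m) N
    𝓕₀ : Subset N

-- The universe is listed explicitly (in unary), sets and subfamilies are
-- given by characteristic vectors.

encSetSystem : SetSystem → Tree
encSetSystem S =
  node (encUnary m) (node (encVec (encVec encBool) 𝓕) (encVec encBool 𝓕₀))
  where open SetSystem S

module _ (S : SetSystem) where
  open SetSystem S

  PairwiseDisjoint : Subset N → Set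
  PairwiseDisjoint 𝓖 =
    ∀ {i j} → i ∈ 𝓖 → j ∈ 𝓖 → i ≢ j → Empty (lookup 𝓕 i ∩ lookup 𝓕 j)

  -- Divisibility of m by 3 and the successor make m / 3 and m / 3 - 1
  -- exact: there is neither rounding nor truncated subtraction.

  record IsValid : Set where
    field
      no-repetition : Injective _≡_ _≡_ (lookup 𝓕)
      triples       : ∀ i → ∣ lookup 𝓕 i ∣ ≡ 3
      3∣m           : 3 ∣ m
      disjoint₀     : PairwiseDisjoint 𝓕₀
      card₀         : suc ∣ 𝓕₀ ∣ ≡ m / 3

  IsPerfectPacking : Subset N → Set
  IsPerfectPacking 𝓖 = PairwiseDisjoint 𝓖 × ∣ 𝓖 ∣ ≡ m / 3

{-# OPTIONS --safe #-}

-- A clique is spread over a K × K torus of cells: cell (i , j) chooses a pair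
-- (u , v), which must be an edge if i ≠ j and satisfy u ≡ v if i ≡ j; horizontal
-- neighbours have to agree on u and vertical neighbours on v.  The default packing
-- contains for every cell and every pair the sets P and Q, carrying the ports
-- p₀ p₁ p₂ and q₀ q₁ q₂ of the pair, and for every cell except (0 , 0) the set T
-- of the three elements tᵉ tʰ tᵛ.  To cover tᵉ 0 0 a packing must contain some set
-- E = {p₀ , q₀ , tᵉ}, that is, choose a pair.  This expels the sets P and Q of that
-- pair, so q₁ has to be covered by a set H = {p₁ , q₁ , tʰ}, where p₁ belongs to the
-- right neighbour and a pair with the same u; that in turn expels P over there,
-- which forces a choice in the right neighbour, and likewise downwards with
-- V = {p₂ , q₂ , tᵛ}.  So all cells choose consistently, and each chooses only once
-- as its tᵉ is covered once.  Conversely a clique yields a perfect packing with just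
-- three new sets E, H, V per cell.
--
-- Colors enter only through the graph: pairs of equal color are made nonadjacent,
-- after which any K-clique is multicolored.
--
-- The running time is obtained by composing programs that carry polynomial bounds;
-- the only source of iteration is a fold with an invariant that bounds its state.

module Submission where

open import Defs
open import Data.Bool using (Bool; true; false; not; _∧_; _∨_; if_then_else_; T)
open import Data.Bool.Properties using (T-≡; T-∧; T-∨)
open import Data.Empty using (⊥; ⊥-elim)
open import Data.Fin as Fin using (Fin; zero; suc; toℕ; fromℕ<)
import Data.Fin.Properties as Fin
open import Data.Fin.Subset using (Subset; _─_; ∣_∣) renaming (_∈_ to _∈ₛ_; _∉_ to _∉ₛ_)
open import Data.Fin.Subset.Properties using (x∈p∩q⁺; x∈p∩q⁻; ∣p∣≤n; p─q⊆p)
open import Data.List using (List; []; _∷_; [_]; _++_; concatMap; downFrom; foldl; foldr; length; lookup; map; replicate; reverse; reverseAcc)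
import Data.List as List
import Data.List.Membership.DecPropositional as DecMembership
open import Data.List.Membership.Propositional using (_∈_; _∉_; find; lose)
open import Data.List.Membership.Propositional.Properties using (∈-lookup; ∈-map⁺; ∈-map⁻; ∈-concatMap⁺; ∈-concatMap⁻; ∈-++⁻; ∈-++⁺ˡ; ∈-++⁺ʳ; ∈-downFrom⁺; ∈-downFrom⁻)
import Data.List.Membership.Propositional.Properties as ∈
open import Data.List.Properties using (ʳ++-defn; foldl-++; length-++; length-downFrom; length-map; length-replicate; length-tabulate; reverse-foldl; reverse-involutive)
open import Data.List.Relation.Binary.Subset.Propositional using (_⊆_)
open import Data.List.Relation.Unary.All as All using (All; []; _∷_)
import Data.List.Relation.Unary.All.Properties as All
open import Data.List.Relation.Unary.AllPairs using ([]; _∷_)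
open import Data.List.Relation.Unary.Any using (here; there; index)
open import Data.List.Relation.Unary.Any.Properties using (lookup-index)
open import Data.List.Relation.Unary.Unique.Propositional using (Unique)
import Data.List.Relation.Unary.Unique.Propositional.Properties as Unique
open import Data.Nat using (ℕ; zero; suc; pred; _+_; _*_; _^_; _/_; _⊓_; _≤_; _<_; _>_; _≡ᵇ_; _<ᵇ_; z≤n; s≤s)
open import Data.Nat.Binary using (ℕᵇ; zero; 2[1+_]; 1+[2_]; fromℕ) renaming (toℕ to valᵇ)
open import Data.Nat.Binary.Properties using (toℕ-fromℕ)
open import Data.Nat.DivMod using (m*n/n≡m; m/n*n≡m)
open import Data.Nat.Divisibility using (_∣_; divides)
open import Data.Nat.Properties
open import Data.Nat.Solver using (module +-*-Solver)
open import Data.Product using (Σ-syntax; ∃-syntax; _×_; _,_; proj₁; proj₂)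
open import Data.Product.Properties using (≡-dec)
open import Data.Sum using (_⊎_; inj₁; inj₂; [_,_]′)
open import Data.Vec as Vec using ([]; _∷_; here; there; tabulate; toList)
open import Data.Vec.Properties using (lookup∘tabulate; lookup⇒[]=; []=⇒lookup; length-toList)
open import Function using (_∘_; flip; Equivalence; Injective)
open import Relation.Binary.Definitions using (DecidableEquality)
open import Relation.Binary.PropositionalEquality using (_≡_; _≢_; refl; sym; trans; cong; cong₂; subst)
open import Relation.Nullary using (¬_; yes; no; contradiction)
open import Relation.Nullary.Decidable using (isYes; toWitness; fromWitness)
open +-*-Solver using (solve; _:+_; _:*_; _:^_; _:=_) renaming (con to :con)

private variable
  A B : Set

-- Polynomial-time programs on typed data

-- Time bounds are kept as syntax. Coefficients are natural numbers, so every bound is monotone, and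
-- substitution supplies the bound of a composition.
data Pol : Set where
  con     : ℕ → Pol
  var     : Pol
  _⊕_ _⊛_ : Pol → Pol → Pol

infixl 6 _⊕_
infixl 7 _⊛_

eval : Pol → ℕ → ℕ
eval (con c) s = c
eval var     s = s
eval (p ⊕ q) s = eval p s + eval q s
eval (p ⊛ q) s = eval p s * eval q s

eval-mono : ∀ p {s t} → s ≤ t → eval p s ≤ eval p t
eval-mono (con c) s≤t = ≤-refl
eval-mono var     s≤t = s≤t
eval-mono (p ⊕ q) s≤t = +-mono-≤ (eval-mono p s≤t) (eval-mono q s≤t)
eval-mono (p ⊛ q) s≤t = *-mono-≤ (eval-mono p s≤t) (eval-mono q s≤t)

subst-pol : Pol → Pol → Pol
subst-pol (con c) r = con c
subst-pol var     r = r
subst-pol (p ⊕ q) r = subst-pol p r ⊕ subst-pol q r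
subst-pol (p ⊛ q) r = subst-pol p r ⊛ subst-pol q r

eval-subst : ∀ p r s → eval (subst-pol p r) s ≡ eval p (eval r s)
eval-subst (con c) r s = refl
eval-subst var     r s = refl
eval-subst (p ⊕ q) r s = cong₂ _+_ (eval-subst p r s) (eval-subst q r s)
eval-subst (p ⊛ q) r s = cong₂ _*_ (eval-subst p r s) (eval-subst q r s)

-- Links `Pol` to the form of bound that `PolyTime` asks for. At a positive argument a power only
-- grows with its exponent, so `d + f` serves as a common exponent for a sum; at 0 this would fail.
monomial-bound : ∀ p → ∃[ c ] ∃[ d ] (∀ s → eval p (suc s) ≤ c * suc s ^ d)
monomial-bound (con c) = c , 0 , λ s → ≤-reflexive (sym (*-identityʳ c))
monomial-bound var     = 1 , 1 , λ s → ≤-reflexive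
  (sym (trans (*-identityˡ _) (*-identityʳ _)))
monomial-bound (p ⊕ q) =
  let c , d , hp = monomial-bound p
      e , f , hq = monomial-bound q
  in c + e , d + f , λ s → ≤-trans
       (+-mono-≤ (≤-trans (hp s) (*-monoʳ-≤ c (^-monoʳ-≤ (suc s) (m≤m+n d f))))
                 (≤-trans (hq s) (*-monoʳ-≤ e (^-monoʳ-≤ (suc s) (m≤n+m f d)))))
       (≤-reflexive (sym (*-distribʳ-+ (suc s ^ (d + f)) c e)))
monomial-bound (p ⊛ q) =
  let c , d , hp = monomial-bound p
      e , f , hq = monomial-bound q
  in c * e , d + f , λ s → ≤-trans (*-mono-≤ (hp s) (hq s)) (≤-reflexive
       (trans ([m*n]*[o*p]≡[m*o]*[n*p] c (suc s ^ d) e (suc s ^ f))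
              (cong (c * e *_) (sym (^-distribˡ-+-* (suc s) d f)))))

0<size : ∀ x → 1 ≤ size x
0<size nil        = s≤s z≤n
0<size (node x y) = s≤s z≤n

-- Every rule charges at least the size of what it produces. Hence a time bound also bounds the
-- input of whatever program runs next.
output≤time : ∀ {p x y t} → p ⊢ x ⇓ y [ t ] → size y ≤ t
output≤time skip⇓ = ≤-refl
output≤time {x = x} empty⇓ = 0<size x
output≤time hd-nil⇓ = ≤-refl
output≤time (hd-node⇓ {x} {y}) = m≤n⇒m≤1+n (m≤m+n (size x) (size y))
output≤time tl-nil⇓ = ≤-refl
output≤time (tl-node⇓ {x} {y}) = m≤n⇒m≤1+n (m≤n+m (size y) (size x))
output≤time {x = x} (cons⇓ a b) =
  +-mono-≤ (0<size x) (+-mono-≤ (output≤time a) (output≤time b))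
output≤time {x = x} (seq⇓ {s = s} a b) =
  ≤-trans (output≤time b) (≤-trans (m≤n+m _ s) (m≤n+m _ (size x)))
output≤time {x = x} (cond-yes⇓ {s = s} a b) =
  ≤-trans (output≤time b) (≤-trans (m≤n+m _ s) (m≤n+m _ (size x)))
output≤time {x = x} (cond-no⇓ {s = s} a b) =
  ≤-trans (output≤time b) (≤-trans (m≤n+m _ s) (m≤n+m _ (size x)))
output≤time {x = x} (while-yes⇓ {r = r} {s = s} a b c) =
  ≤-trans (output≤time c) (≤-trans (m≤n+m _ s) (≤-trans (m≤n+m _ r) (m≤n+m _ (size x))))
output≤time (while-no⇓ a) = m≤m+n _ _

Within : Prog → Tree → Tree → ℕ → Set
Within p x y b = ∃[ t ] (p ⊢ x ⇓ y [ t ] × t ≤ b)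

cons-within : ∀ {p q x y z s t} → Within p x y s → Within q x z t →
              Within (cons p q) x (node y z) (size x + (s + t))
cons-within {x = x} (_ , a , l) (_ , b , m) = _ , cons⇓ a b , +-monoʳ-≤ (size x) (+-mono-≤ l m)

seq-within : ∀ {p q x y z s t} → Within p x y s → Within q y z t →
             Within (p ⨾ q) x z (size x + (s + t))
seq-within {x = x} (_ , a , l) (_ , b , m) = _ , seq⇓ a b , +-monoʳ-≤ (size x) (+-mono-≤ l m)

weaken : ∀ {p x y s t} → s ≤ t → Within p x y s → Within p x y t
weaken s≤t (_ , a , l) = _ , a , ≤-trans l s≤t

infixr 5 _⊗_

data Ty : Set where
  bool nat : Ty
  list     : Ty → Ty
  _⊗_      : Ty → Ty → Ty

⟦_⟧ : Ty → Set
⟦ bool ⟧   = Bool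
⟦ nat ⟧    = ℕ
⟦ list a ⟧ = List ⟦ a ⟧
⟦ a ⊗ b ⟧  = ⟦ a ⟧ × ⟦ b ⟧

enc : (a : Ty) → ⟦ a ⟧ → Tree
enc bool     b       = encBool b
enc nat      n       = encUnary n
enc (list a) xs      = encList (enc a) xs
enc (a ⊗ b)  (x , y) = node (enc a x) (enc b y)

sz : (a : Ty) → ⟦ a ⟧ → ℕ
sz a x = size (enc a x)

record Poly (a b : Ty) (f : ⟦ a ⟧ → ⟦ b ⟧) : Set where
  field
    prog : Prog
    bnd  : Pol
    run  : ∀ x → Within prog (enc a x) (enc b (f x)) (eval bnd (sz a x))

  sz-bnd : ∀ x → sz b (f x) ≤ eval bnd (sz a x)
  sz-bnd x = let _ , r , l = run x in ≤-trans (output≤time r) l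

open Poly

-- The machine sees only trees, so a program may be retyped whenever encodings coincide. In
-- particular `[]`, `false` and `0` are all `nil`, and a number is the same tree as a list of that
-- many `false`.
recode : ∀ {a b c f g} → Poly a b f → (∀ x → enc b (f x) ≡ enc c (g x)) → Poly a c g
recode F eq .prog = prog F
recode F eq .bnd  = bnd F
recode F eq .run x = subst (λ y → Within (prog F) _ y _) (eq x) (run F x)

ext : ∀ {a b f g} → Poly a b f → (∀ x → f x ≡ g x) → Poly a b g
ext {b = b} F eq = recode F (cong (enc b) ∘ eq)

infixr 9 _∘ₚ_

_∘ₚ_ : ∀ {a b c g f} → Poly b c g → Poly a b f → Poly a c (λ x → g (f x))
(G ∘ₚ F) .prog = prog F ⨾ prog G
(G ∘ₚ F) .bnd  = var ⊕ (bnd F ⊕ subst-pol (bnd G) (bnd F))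
_∘ₚ_ {a} {f = f} G F .run x =
  seq-within (run F x) (weaken le (run G (f x)))
  where
  -- The intermediate value is no larger than the time spent on computing it, so `bnd G` may be
  -- evaluated at `bnd F`.
  le = ≤-trans (eval-mono (bnd G) (sz-bnd F x))
               (≤-reflexive (sym (eval-subst (bnd G) (bnd F) (sz a x))))

idₚ : ∀ {a} → Poly a a (λ x → x)
idₚ .prog  = skip
idₚ .bnd   = var
idₚ .run x = _ , skip⇓ , ≤-refl

fstₚ : ∀ {a b} → Poly (a ⊗ b) a proj₁
fstₚ .prog = hd
fstₚ .bnd  = var
fstₚ .run (x , y) = _ , hd-node⇓ , ≤-refl

sndₚ : ∀ {a b} → Poly (a ⊗ b) b proj₂
sndₚ .prog = tl
sndₚ .bnd  = var
sndₚ .run (x , y) = _ , tl-node⇓ , ≤-refl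

infixr 4 _,ₚ_

_,ₚ_ : ∀ {a b c f g} → Poly a b f → Poly a c g → Poly a (b ⊗ c) (λ x → f x , g x)
(F ,ₚ G) .prog  = cons (prog F) (prog G)
(F ,ₚ G) .bnd   = var ⊕ (bnd F ⊕ bnd G)
(F ,ₚ G) .run x = cons-within (run F x) (run G x)

emptyₚ : ∀ {a} → Poly a (list bool) (λ _ → [])
emptyₚ .prog  = empty
emptyₚ .bnd   = var
emptyₚ .run x = _ , empty⇓ , ≤-refl

[]ₚ : ∀ {a b} → Poly a (list b) (λ _ → [])
[]ₚ = recode emptyₚ λ _ → refl

falseₚ : ∀ {a} → Poly a bool (λ _ → false)
falseₚ = recode emptyₚ λ _ → refl

zeroₚ : ∀ {a} → Poly a nat (λ _ → 0)
zeroₚ = recode emptyₚ λ _ → refl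

trueₚ : ∀ {a} → Poly a bool (λ _ → true)
trueₚ = recode (emptyₚ ,ₚ emptyₚ) λ _ → refl

infixr 5 _∷ₚ_

_∷ₚ_ : ∀ {a b f g} → Poly a b f → Poly a (list b) g → Poly a (list b) (λ x → f x ∷ g x)
F ∷ₚ G = recode (F ,ₚ G) λ _ → refl

sucₚ : ∀ {a f} → Poly a nat f → Poly a nat (λ x → suc (f x))
sucₚ F = recode (falseₚ ,ₚ F) λ _ → refl

constₚ : ∀ {a} n → Poly a nat (λ _ → n)
constₚ zero    = zeroₚ
constₚ (suc n) = sucₚ (constₚ n)

ifₚ : ∀ {a b t f g} → Poly a bool t → Poly a b f → Poly a b g →
      Poly a b (λ x → if t x then f x else g x)
ifₚ T F G .prog = cond (prog T) (prog F) (prog G)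
ifₚ T F G .bnd  = var ⊕ (bnd T ⊕ (bnd F ⊕ bnd G))
ifₚ {a} {t = t} T F G .run x with t x | run T x
... | true  | _ , r , l = let _ , s , m = run F x in
  _ , cond-yes⇓ r s , +-monoʳ-≤ (sz a x) (+-mono-≤ l (m≤n⇒m≤n+o _ m))
... | false | _ , r , l = let _ , s , m = run G x in
  _ , cond-no⇓ r s , +-monoʳ-≤ (sz a x) (+-mono-≤ l (m≤n⇒m≤o+n (eval (bnd F) (sz a x)) m))

tail : ∀ {A : Set} → List A → List A
tail []       = []
tail (x ∷ xs) = xs

tailₚ : ∀ {b} → Poly (list b) (list b) tail
tailₚ .prog = tl
tailₚ .bnd  = var
tailₚ .run []       = _ , tl-nil⇓ , ≤-refl
tailₚ .run (x ∷ xs) = _ , tl-node⇓ , ≤-refl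

headOr : ∀ {A : Set} → A → List A → A
headOr d []      = d
headOr d (x ∷ _) = x

-- The machine's hd maps nil to nil, so the default must be encoded by nil.
headₚ : ∀ {b} d → enc b d ≡ nil → Poly (list b) b (headOr d)
headₚ d eq .prog = hd
headₚ d eq .bnd  = var
headₚ d eq .run [] rewrite eq = _ , hd-nil⇓ , ≤-refl
headₚ d eq .run (x ∷ xs) = _ , hd-node⇓ , ≤-refl

nonEmpty : ∀ {A : Set} → List A → Bool
nonEmpty []      = false
nonEmpty (_ ∷ _) = true

nonEmptyₚ : ∀ {b} → Poly (list b) bool nonEmpty
nonEmptyₚ {b} .prog = cond skip (cons empty empty) empty
nonEmptyₚ .bnd  = var ⊕ (var ⊕ (var ⊕ (var ⊕ var)))
nonEmptyₚ .run [] = _ , cond-no⇓ skip⇓ empty⇓ , s≤s (s≤s (s≤s z≤n))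
nonEmptyₚ .run (x ∷ xs) = _ , cond-yes⇓ skip⇓ (cons⇓ empty⇓ empty⇓) , ≤-refl

-- Iteration by folding over a list

length≤sz : ∀ a xs → suc (length xs) ≤ sz (list a) xs
length≤sz a []       = ≤-refl
length≤sz a (x ∷ xs) = s≤s (≤-trans (length≤sz a xs) (m≤n+m _ (sz a x)))

-- Folding a polynomial-time step can grow its state exponentially; the invariant
-- Inv x ys u (on input x, with ys still to be read, the state is u) excludes this.
module _ {a b s : Ty} {l : ⟦ a ⟧ → List ⟦ b ⟧} {z : ⟦ a ⟧ → ⟦ s ⟧} {f : (⟦ a ⟧ × ⟦ s ⟧) × ⟦ b ⟧ → ⟦ s ⟧}
         (L : Poly a (list b) l) (Z : Poly a s z) (F : Poly ((a ⊗ s) ⊗ b) s f)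
         (B : Pol) (Inv : ⟦ a ⟧ → List ⟦ b ⟧ → ⟦ s ⟧ → Set)
         (start : ∀ x → Inv x (l x) (z x))
         (step  : ∀ x y ys u → Inv x (y ∷ ys) u → Inv x ys (f ((x , u) , y)))
         (small : ∀ x ys u → Inv x ys u → sz s u ≤ eval B (sz a x))
  where

  private
    -- The loop holds the unread list, the state and the input. A nonempty list has the same
    -- encoding as the pair of its head and tail, which is why the domain contains `b ⊗ list b`; the
    -- loop test `hd` yields the unread list, which is `nil` exactly when nothing is left.
    body : Poly ((b ⊗ list b) ⊗ (s ⊗ a)) (list b ⊗ (s ⊗ a))
                (λ ((y , ys) , (u , x)) → ys , (f ((x , u) , y) , x))
    body = sndₚ ∘ₚ fstₚ
        ,ₚ F ∘ₚ ((sndₚ ∘ₚ sndₚ ,ₚ fstₚ ∘ₚ sndₚ) ,ₚ fstₚ ∘ₚ fstₚ)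
        ,ₚ sndₚ ∘ₚ sndₚ

    init : Poly a (list b ⊗ (s ⊗ a)) (λ x → l x , (z x , x))
    init = L ,ₚ (Z ,ₚ idₚ)

    stateBnd iterBnd loopBnd : Pol
    stateBnd = con 1 ⊕ (bnd L ⊕ (con 1 ⊕ (B ⊕ var)))
    iterBnd  = stateBnd ⊕ (stateBnd ⊕ subst-pol (bnd body) stateBnd)
    loopBnd  = (con 1 ⊕ bnd L) ⊛ iterBnd

    module _ (x : ⟦ a ⟧) where
      M W I : ℕ
      M = eval stateBnd (sz a x)
      W = eval (subst-pol (bnd body) stateBnd) (sz a x)
      I = M + (M + W)

      state≤M : ∀ ys u → Inv x ys u → sz (list b) ys ≤ sz (list b) (l x) →
                sz (list b ⊗ (s ⊗ a)) (ys , (u , x)) ≤ M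
      state≤M ys u inv le = s≤s (+-mono-≤ (≤-trans le (sz-bnd L x))
        (s≤s (+-monoˡ-≤ (sz a x) (small x ys u inv))))

      -- One round costs at most `M` for the `while`, `M` for its test and `W` for the body,
      -- uniformly because the invariant keeps the state small. The successor in the bound pays for
      -- the last, failing test.
      loop : ∀ ys u → Inv x ys u → sz (list b) ys ≤ sz (list b) (l x) →
             Within (while hd (prog body)) (enc (list b ⊗ (s ⊗ a)) (ys , (u , x)))
                    (enc (list b ⊗ (s ⊗ a)) ([] , (foldl (λ u y → f ((x , u) , y)) u ys , x)))
                    (suc (length ys) * I)
      loop [] u inv le = _ , while-no⇓ hd-node⇓ , ≤-trans
        (+-mono-≤ (state≤M [] u inv le) (≤-trans (state≤M [] u inv le) (m≤m+n M W)))
        (≤-reflexive (sym (*-identityˡ I)))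
      loop (y ∷ ys) u inv le =
        let _ , r , m = run body ((y , ys) , (u , x))
            _ , r′ , m′ = loop ys _ (step x y ys u inv)
                            (≤-trans (m≤n⇒m≤1+n (m≤n+m _ (sz b y))) le)
            st = state≤M (y ∷ ys) u inv le
            w = ≤-trans m (≤-trans (eval-mono (bnd body) st)
                  (≤-reflexive (sym (eval-subst (bnd body) stateBnd (sz a x)))))
        in _ , while-yes⇓ hd-node⇓ r r′ , ≤-trans
             (+-mono-≤ st (+-mono-≤ st (+-mono-≤ w m′)))
             (≤-reflexive (trans (cong (M +_) (sym (+-assoc M W _))) (sym (+-assoc M (M + W) _))))

      Inv-end : ∀ ys u → Inv x ys u → Inv x [] (foldl (λ u y → f ((x , u) , y)) u ys)
      Inv-end []       u inv = inv
      Inv-end (y ∷ ys) u inv = Inv-end ys _ (step x y ys u inv)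

      result : Within (prog init ⨾ (while hd (prog body) ⨾ (tl ⨾ hd))) (enc a x)
                 (enc s (foldl (λ u y → f ((x , u) , y)) (z x) (l x)))
                 (sz a x + (eval (bnd init) (sz a x) + (M + (eval loopBnd (sz a x) + (M + (M + M))))))
      result = seq-within (run init x)
        (weaken (+-monoˡ-≤ _ (state≤M (l x) (z x) (start x) ≤-refl))
          (seq-within
            (weaken (*-monoˡ-≤ I (s≤s (≤-trans (n≤1+n _) (≤-trans (length≤sz b (l x)) (sz-bnd L x)))))
              (loop (l x) (z x) (start x) ≤-refl))
            (weaken (+-mono-≤ end (+-mono-≤ end (≤-trans (m≤n+m _ 2) end)))
              (seq-within (_ , tl-node⇓ , ≤-refl) (_ , hd-node⇓ , ≤-refl)))))
        where
        end = state≤M [] _ (Inv-end (l x) (z x) (start x)) (≤-trans (s≤s z≤n) (length≤sz b (l x)))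

  foldₚ : Poly a s (λ x → foldl (λ u y → f ((x , u) , y)) (z x) (l x))
  foldₚ .prog = prog init ⨾ (while hd (prog body) ⨾ (tl ⨾ hd))
  foldₚ .bnd  = var ⊕ (bnd init ⊕ (stateBnd ⊕ (loopBnd ⊕ (stateBnd ⊕ (stateBnd ⊕ stateBnd)))))
  foldₚ .run  = result

-- Operations on lists, Booleans and unary numbers

reverseAccₚ : ∀ {a b z l} → Poly a (list b) z → Poly a (list b) l →
              Poly a (list b) (λ x → reverseAcc (z x) (l x))
reverseAccₚ {a} {b} {z} {l} Z L = foldₚ L Z (sndₚ ∷ₚ (sndₚ ∘ₚ fstₚ)) (bnd Z ⊕ bnd L)
  -- Each element moves from the unread list to the accumulator, which leaves the total size
  -- unchanged.
  (λ x ys u → sz (list b) u + sz (list b) ys ≤ sz (list b) (z x) + sz (list b) (l x))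
  (λ x → ≤-refl)
  (λ x y ys u → ≤-trans (≤-reflexive
    (solve 3 (λ p q r → :con 1 :+ (p :+ q) :+ r := q :+ (:con 1 :+ (p :+ r))) refl (sz b y) (sz (list b) u) (sz (list b) ys))))
  (λ x ys u inv → ≤-trans (m≤m+n _ _) (≤-trans inv (+-mono-≤ (sz-bnd Z x) (sz-bnd L x))))

reverseₚ : ∀ {a b l} → Poly a (list b) l → Poly a (list b) (λ x → reverse (l x))
reverseₚ = reverseAccₚ []ₚ

infixr 5 _++ₚ_

_++ₚ_ : ∀ {a b f g} → Poly a (list b) f → Poly a (list b) g → Poly a (list b) (λ x → f x ++ g x)
_++ₚ_ {f = f} {g} F G = ext (reverseAccₚ G (reverseₚ F)) λ x →
  trans (ʳ++-defn (reverse (f x))) (cong (_++ g x) (reverse-involutive (f x)))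

sz-reverseAcc : ∀ b u zs → sz (list b) (reverseAcc u zs) ≤ sz (list b) u + sz (list b) zs
sz-reverseAcc b u []       = m≤m+n _ _
sz-reverseAcc b u (z ∷ zs) = ≤-trans (sz-reverseAcc b (z ∷ u) zs) (≤-reflexive
  (solve 3 (λ p q r → :con 1 :+ (p :+ q) :+ r := q :+ (:con 1 :+ (p :+ r))) refl (sz b z) (sz (list b) u) (sz (list b) zs)))

foldl-reverseAcc : ∀ {A B : Set} (h : A → List B) acc ys →
  foldl (λ u y → reverseAcc u (h y)) acc ys ≡ reverseAcc acc (concatMap h ys)
foldl-reverseAcc h acc []       = refl
foldl-reverseAcc h acc (y ∷ ys) = trans (foldl-reverseAcc h (reverseAcc acc (h y)) ys)
  (sym (foldl-++ (flip _∷_) acc (h y) (concatMap h ys)))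

-- The blocks are accumulated in reverse and turned around once at the end. The invariant reserves a
-- budget `M x` for every unread element, which suffices for the block of that element.
concatMapₚ : ∀ {a b c l g} → Poly a (list b) l → Poly (a ⊗ b) (list c) g →
             Poly a (list c) (λ x → concatMap (λ y → g (x , y)) (l x))
concatMapₚ {a} {b} {c} {l} {g} L G = ext
  (reverseₚ (foldₚ L []ₚ (reverseAccₚ (sndₚ ∘ₚ fstₚ) (G ∘ₚ (fstₚ ∘ₚ fstₚ ,ₚ sndₚ)))
    (con 1 ⊕ bnd L ⊛ gBnd) Inv
    (λ x → ≤-refl , ≤-refl) step small))
  λ x → trans (cong reverse (foldl-reverseAcc _ [] (l x))) (reverse-involutive _)
  where
  -- The pair `(x , y)` costs one node besides its components, and `y` is part of `l x`, hence at
  -- most `bnd L` in size.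
  gBnd = subst-pol (bnd G) (con 1 ⊕ (var ⊕ bnd L))

  M : ⟦ a ⟧ → ℕ
  M x = eval gBnd (sz a x)

  Inv : ⟦ a ⟧ → List ⟦ b ⟧ → List ⟦ c ⟧ → Set
  Inv x ys u = sz (list b) ys ≤ sz (list b) (l x) ×
               sz (list c) u + length ys * M x ≤ 1 + length (l x) * M x

  step : ∀ x y ys u → Inv x (y ∷ ys) u → Inv x ys (reverseAcc u (g (x , y)))
  step x y ys u (le , inv) = ≤-trans (m≤n⇒m≤1+n (m≤n+m _ (sz b y))) le ,
    ≤-trans (+-monoˡ-≤ _ (≤-trans (sz-reverseAcc c u _) (+-monoʳ-≤ (sz (list c) u) out)))
      (≤-trans (≤-reflexive (+-assoc (sz (list c) u) (M x) _)) inv)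
    where
    out : sz (list c) (g (x , y)) ≤ M x
    out = ≤-trans (sz-bnd G (x , y)) (≤-trans
      (eval-mono (bnd G) (s≤s (+-monoʳ-≤ (sz a x)
        (≤-trans (m≤n⇒m≤1+n (m≤m+n (sz b y) _)) (≤-trans le (sz-bnd L x))))))
      (≤-reflexive (sym (eval-subst (bnd G) (con 1 ⊕ (var ⊕ bnd L)) (sz a x)))))

  small : ∀ x ys u → Inv x ys u → sz (list c) u ≤ 1 + eval (bnd L) (sz a x) * M x
  small x ys u (_ , inv) = ≤-trans (m≤m+n _ _) (≤-trans inv
    (s≤s (*-monoˡ-≤ (M x) (≤-trans (n≤1+n _) (≤-trans (length≤sz b (l x)) (sz-bnd L x))))))

concatMap-[_] : ∀ {A B : Set} (h : A → B) xs → concatMap (λ x → [ h x ]) xs ≡ map h xs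
concatMap-[ h ] []       = refl
concatMap-[ h ] (x ∷ xs) = cong (h x ∷_) (concatMap-[ h ] xs)

mapₚ : ∀ {a b c l g} → Poly a (list b) l → Poly (a ⊗ b) c g →
       Poly a (list c) (λ x → map (λ y → g (x , y)) (l x))
mapₚ {l = l} L G = ext (concatMapₚ L (G ∷ₚ []ₚ)) λ x → concatMap-[ _ ] (l x)

∧-if : ∀ b c → (if b then c else false) ≡ b ∧ c
∧-if true  c = refl
∧-if false c = refl

∨-if : ∀ b c → (if b then true else c) ≡ b ∨ c
∨-if true  c = refl
∨-if false c = refl

not-if : ∀ b → (if b then false else true) ≡ not b
not-if true  = refl
not-if false = refl

_∧ₚ_ : ∀ {a f g} → Poly a bool f → Poly a bool g → Poly a bool (λ x → f x ∧ g x)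
_∧ₚ_ {f = f} {g} F G = ext (ifₚ F G falseₚ) λ x → ∧-if (f x) (g x)

_∨ₚ_ : ∀ {a f g} → Poly a bool f → Poly a bool g → Poly a bool (λ x → f x ∨ g x)
_∨ₚ_ {f = f} {g} F G = ext (ifₚ F trueₚ G) λ x → ∨-if (f x) (g x)

notₚ : ∀ {a f} → Poly a bool f → Poly a bool (λ x → not (f x))
notₚ F = ext (ifₚ F falseₚ trueₚ) λ x → not-if _

infixr 6 _∧ₚ_
infixr 5 _∨ₚ_

eqBool : Bool → Bool → Bool
eqBool b c = if b then c else not c

eqBits : List Bool → List Bool → Bool
eqBits []       ys       = not (nonEmpty ys)
eqBits (x ∷ xs) []       = false
eqBits (x ∷ xs) (y ∷ ys) = eqBool x y ∧ eqBits xs ys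

-- Recasts `eqBits` as a fold over the first list: the state carries the verdict so far and the
-- unread part of the second list. The default `false` of `headOr` cannot be mistaken for an entry,
-- as `nonEmpty` is tested as well.
eqStep : Bool × List Bool → Bool → Bool × List Bool
eqStep (b , ys) x = b ∧ (nonEmpty ys ∧ eqBool x (headOr false ys)) , tail ys

foldl-false : ∀ xs ys → proj₁ (foldl eqStep (false , ys) xs) ≡ false
foldl-false []       ys = refl
foldl-false (x ∷ xs) ys = foldl-false xs (tail ys)

foldl-eqStep : ∀ xs ys → let b , zs = foldl eqStep (true , ys) xs in
               b ∧ not (nonEmpty zs) ≡ eqBits xs ys
foldl-eqStep [] ys = refl
foldl-eqStep (x ∷ xs) [] = cong (_∧ not (nonEmpty (proj₂ (foldl eqStep (false , []) xs)))) (foldl-false xs [])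
foldl-eqStep (x ∷ xs) (y ∷ ys) with eqBool x y
... | true  = foldl-eqStep xs ys
... | false = cong (_∧ not (nonEmpty (proj₂ (foldl eqStep (false , ys) xs)))) (foldl-false xs ys)

sz-tail : ∀ b xs → sz (list b) (tail xs) ≤ sz (list b) xs
sz-tail b []       = ≤-refl
sz-tail b (x ∷ xs) = m≤n⇒m≤1+n (m≤n+m _ (sz b x))

sz-bool : ∀ b → sz bool b ≤ 3
sz-bool true  = ≤-refl
sz-bool false = s≤s z≤n

eqBitsₚ : ∀ {a f g} → Poly a (list bool) f → Poly a (list bool) g →
          Poly a bool (λ x → eqBits (f x) (g x))
eqBitsₚ {a} {f} {g} F G = ext
  ((fstₚ ∧ₚ notₚ (nonEmptyₚ ∘ₚ sndₚ)) ∘ₚ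
    foldₚ {f = λ ((x , u) , y) → eqStep u y} F (trueₚ ,ₚ G)
      (fstₚ ∘ₚ sndₚ ∘ₚ fstₚ ∧ₚ (nonEmptyₚ ∘ₚ rest ∧ₚ ifₚ sndₚ hd₁ (notₚ hd₁))
        ,ₚ tailₚ ∘ₚ rest)
      -- One for the pairing node and at most three for the verdict.
      (con 4 ⊕ bnd G)
      (λ x _ u → sz (list bool) (proj₂ u) ≤ sz (list bool) (g x))
      (λ x → ≤-refl)
      (λ x y ys u → ≤-trans (sz-tail bool (proj₂ u)))
      (λ x ys u inv → s≤s (+-mono-≤ (sz-bool (proj₁ u)) (≤-trans inv (sz-bnd G x)))))
  λ x → foldl-eqStep (f x) (g x)
  where
  rest : ∀ {c} → Poly ((a ⊗ (bool ⊗ list bool)) ⊗ c) (list bool) (λ ((_ , u) , _) → proj₂ u)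
  rest = sndₚ ∘ₚ sndₚ ∘ₚ fstₚ
  hd₁ : ∀ {c} → Poly ((a ⊗ (bool ⊗ list bool)) ⊗ c) bool (λ ((_ , u) , _) → headOr false (proj₂ u))
  hd₁ = headₚ false refl ∘ₚ rest

bitsₚ : ∀ {a f} → Poly a nat f → Poly a (list bool) (λ x → replicate (f x) false)
bitsₚ F = recode F λ _ → refl

eqBits-replicate : ∀ m n → eqBits (replicate m false) (replicate n false) ≡ (m ≡ᵇ n)
eqBits-replicate zero    zero    = refl
eqBits-replicate zero    (suc n) = refl
eqBits-replicate (suc m) zero    = refl
eqBits-replicate (suc m) (suc n) = eqBits-replicate m n

infix 7 _≡ₚ_

_≡ₚ_ : ∀ {a f g} → Poly a nat f → Poly a nat g → Poly a bool (λ x → f x ≡ᵇ g x)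
_≡ₚ_ {f = f} {g} F G = ext (eqBitsₚ (bitsₚ F) (bitsₚ G)) λ x → eqBits-replicate (f x) (g x)

lengthₚ : ∀ {a b l} → Poly a (list b) l → Poly a nat (λ x → length (l x))
lengthₚ {l = l} L = recode (mapₚ L falseₚ) λ x → cong (encList encBool) (map-false (l x))
  where
  map-false : ∀ {A : Set} (xs : List A) → map (λ _ → false) xs ≡ replicate (length xs) false
  map-false []       = refl
  map-false (x ∷ xs) = cong (false ∷_) (map-false xs)

-- Unary addition is concatenation, and since all entries are equal, their reversal does no harm.
reverseAcc-replicate : ∀ m n → reverseAcc (replicate n false) (replicate m false) ≡ replicate (m + n) false
reverseAcc-replicate zero    n = refl
reverseAcc-replicate (suc m) n = trans (reverseAcc-replicate m (suc n))
  (cong (λ k → replicate k false) (+-suc m n))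

infixr 6 _+ₚ_

_+ₚ_ : ∀ {a f g} → Poly a nat f → Poly a nat g → Poly a nat (λ x → f x + g x)
_+ₚ_ {f = f} {g} F G = recode (reverseAccₚ (bitsₚ G) (bitsₚ F)) λ x →
  cong (encList encBool) (reverseAcc-replicate (f x) (g x))

drop : ∀ {A : Set} → ℕ → List A → List A
drop zero    xs = xs
drop (suc n) xs = drop n (tail xs)

foldl-tail : ∀ {A : Set} n (xs : List A) → foldl (λ u _ → tail u) xs (replicate n false) ≡ drop n xs
foldl-tail zero    xs = refl
foldl-tail (suc n) xs = foldl-tail n (tail xs)

dropₚ : ∀ {a b i l} → Poly a nat i → Poly a (list b) l → Poly a (list b) (λ x → drop (i x) (l x))
dropₚ {b = b} {i} {l} I L = ext
  (foldₚ (bitsₚ I) L (tailₚ ∘ₚ sndₚ ∘ₚ fstₚ) (bnd L)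
    (λ x _ u → sz (list b) u ≤ sz (list b) (l x))
    (λ x → ≤-refl)
    (λ x y ys u → ≤-trans (sz-tail b u))
    (λ x ys u inv → ≤-trans inv (sz-bnd L x)))
  λ x → foldl-tail (i x) (l x)

nth : ∀ {A : Set} → A → List A → ℕ → A
nth d xs n = headOr d (drop n xs)

nthₚ : ∀ {a b l i} d → enc b d ≡ nil → Poly a (list b) l → Poly a nat i →
       Poly a b (λ x → nth d (l x) (i x))
nthₚ d eq L I = headₚ d eq ∘ₚ dropₚ I L

-- The minimum of `m` and `r` is what `m` attempts to move a unit from `r` to a counter can
-- transfer. No attempt changes the total size.
⊓-step : ℕ × ℕ → ℕ × ℕ
⊓-step (zero  , a) = zero , a
⊓-step (suc r , a) = r , suc a

⊓-stepₚ : Poly (nat ⊗ nat) (nat ⊗ nat) ⊓-step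
⊓-stepₚ = ext (ifₚ (nonEmptyₚ ∘ₚ bitsₚ fstₚ) (pred′ ,ₚ sucₚ sndₚ) idₚ) λ where
    (zero  , a) → refl
    (suc r , a) → refl
  where
  tail-replicate : ∀ n → tail (replicate n false) ≡ replicate (pred n) false
  tail-replicate zero    = refl
  tail-replicate (suc n) = refl
  pred′ : Poly (nat ⊗ nat) nat (λ (r , _) → pred r)
  pred′ = recode (tailₚ ∘ₚ bitsₚ fstₚ) λ (r , _) → cong (encList encBool) (tail-replicate r)

foldl-⊓ : ∀ m r a → proj₂ (foldl (λ u _ → ⊓-step u) (r , a) (replicate m false)) ≡ m ⊓ r + a
foldl-⊓ zero    r       a = refl
foldl-⊓ (suc m) zero    a = trans (foldl-⊓ m zero a) (cong (_+ a) (⊓-zeroʳ m))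
foldl-⊓ (suc m) (suc r) a = trans (foldl-⊓ m r (suc a)) (+-suc (m ⊓ r) a)

infixr 7 _⊓ₚ_

_⊓ₚ_ : ∀ {a f g} → Poly a nat f → Poly a nat g → Poly a nat (λ x → f x ⊓ g x)
_⊓ₚ_ {a} {f} {g} F G = ext
  (sndₚ ∘ₚ foldₚ (bitsₚ F) (G ,ₚ zeroₚ) (⊓-stepₚ ∘ₚ sndₚ ∘ₚ fstₚ) (con 2 ⊕ bnd G)
    (λ x _ u → sz (nat ⊗ nat) u ≤ sz (nat ⊗ nat) (g x , 0))
    (λ x → ≤-refl)
    (λ x _ _ u → ≤-trans (sz-step u))
    (λ x _ u inv → ≤-trans inv (s≤s (≤-trans (≤-reflexive (+-comm _ 1)) (s≤s (sz-bnd G x))))))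
  λ x → trans (foldl-⊓ (f x) (g x) 0) (+-identityʳ _)
  where
  sz-step : ∀ u → sz (nat ⊗ nat) (⊓-step u) ≤ sz (nat ⊗ nat) u
  sz-step (zero  , a) = ≤-refl
  sz-step (suc r , a) = ≤-reflexive (cong suc (solve 2
    (λ p q → p :+ (:con 2 :+ q) := :con 2 :+ p :+ q) refl (sz nat r) (sz nat a)))

sz-nat-mono : ∀ {m n} → m ≤ n → sz nat m ≤ sz nat n
sz-nat-mono {n = n} z≤n = 0<size (encUnary n)
sz-nat-mono (s≤s m≤n) = s≤s (s≤s (sz-nat-mono m≤n))

downFromₚ : ∀ {a f} → Poly a nat f → Poly a (list nat) (λ x → downFrom (f x))
downFromₚ {a} {f} F = ext
  (sndₚ ∘ₚ foldₚ {f = λ ((x , (c , l)) , y) → suc c , c ∷ l} (bitsₚ F) (zeroₚ ,ₚ []ₚ)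
    (sucₚ cnt ,ₚ (cnt ∷ₚ (sndₚ ∘ₚ sndₚ ∘ₚ fstₚ)))
    (con 2 ⊕ bnd F ⊕ bnd F ⊛ (con 1 ⊕ bnd F))
    -- The invariant determines the state completely. It gives `c ≤ f x`, so the list has at most
    -- `f x` entries, each bounded by the unary size of `f x`.
    (λ x ys u → ∃[ c ] (u ≡ (c , downFrom c) × c + length ys ≡ f x))
    (λ x → 0 , refl , length-replicate (f x))
    (λ { x y ys _ (c , refl , eq) → suc c , refl , trans (sym (+-suc c (length ys))) eq })
    λ { x ys _ (c , refl , eq) → s≤s (bound x c (subst (c ≤_) eq (m≤m+n c _))) })
  λ x → trans (cong proj₂ (foldl-count 0 (f x))) (cong downFrom (+-identityʳ (f x)))
  where
  cnt : ∀ {b} → Poly ((a ⊗ (nat ⊗ list nat)) ⊗ b) nat (λ ((x , (c , l)) , y) → c)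
  cnt = fstₚ ∘ₚ sndₚ ∘ₚ fstₚ

  foldl-count : ∀ c n → foldl (λ u (_ : Bool) → let (c , l) = u in suc c , c ∷ l) (c , downFrom c) (replicate n false)
                ≡ (n + c , downFrom (n + c))
  foldl-count c zero    = refl
  foldl-count c (suc n) = trans (foldl-count (suc c) n) (cong (λ m → m , downFrom m) (+-suc n c))

  sz-downFrom : ∀ {M} c → sz nat c ≤ M → sz (list nat) (downFrom c) ≤ 1 + c * (1 + M)
  sz-downFrom     zero    le = ≤-refl
  sz-downFrom {M} (suc c) le = s≤s (≤-trans
    (+-mono-≤ le′ (sz-downFrom c le′)) (≤-reflexive (+-suc M _)))
    where le′ = ≤-trans (sz-nat-mono (n≤1+n c)) le

  n≤sz : ∀ n → n ≤ sz nat n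
  n≤sz zero    = z≤n
  n≤sz (suc n) = s≤s (m≤n⇒m≤1+n (n≤sz n))

  bound : ∀ x c → c ≤ f x → sz nat c + sz (list nat) (downFrom c) ≤
          1 + eval (bnd F) (sz a x) + eval (bnd F) (sz a x) * (1 + eval (bnd F) (sz a x))
  bound x c le = ≤-trans (+-mono-≤ le′ (≤-trans (sz-downFrom c le′)
      (s≤s (*-monoˡ-≤ _ (≤-trans (n≤sz c) le′)))))
    (≤-reflexive (+-suc _ _))
    where le′ = ≤-trans (sz-nat-mono le) (sz-bnd F x)

-- The reduction on lists and numbers

-- k is given in binary and may be exponential in the input size, so it is evaluated
-- as k ⊓ (n + 1), digit by digit from the most significant one.  The digits true and
-- false stand for 1 and 2 in the bijective numeration of ℕᵇ.  Replacing k > n by n + 1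
-- keeps a NO-instance.
cappedValue : ℕ → List Bool → ℕ
cappedValue c ds = foldl (λ acc d → c ⊓ (acc + (acc + (if d then 1 else 2)))) 0 (reverse ds)

Elem : Set
Elem = ℕ × ℕ × ℕ × ℕ × ℕ

Triple : Set
Triple = Elem × Elem × Elem

-- Elements are tuples (tag , row , column , u , v); those belonging to a cell rather
-- than to a pair have u and v padded with 0.
pattern p₀ i j u v = 0 , i , j , u , v
pattern p₁ i j u v = 1 , i , j , u , v
pattern p₂ i j u v = 2 , i , j , u , v
pattern q₀ i j u v = 3 , i , j , u , v
pattern q₁ i j u v = 4 , i , j , u , v
pattern q₂ i j u v = 5 , i , j , u , v
pattern tᵉ i j = 6 , i , j , 0 , 0
pattern tʰ i j = 7 , i , j , 0 , 0
pattern tᵛ i j = 8 , i , j , 0 , 0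

next : ℕ → ℕ → ℕ
next K j = if suc j ≡ᵇ K then 0 else suc j

setT : ℕ → ℕ → Triple
setT i j = tᵉ i j , tʰ i j , tᵛ i j

setP setQ setE : ℕ → ℕ → ℕ → ℕ → Triple
setP i j u v = p₀ i j u v , p₁ i j u v , p₂ i j u v
setQ i j u v = q₀ i j u v , q₁ i j u v , q₂ i j u v
setE i j u v = p₀ i j u v , q₀ i j u v , tᵉ i j

-- The coordinate that the two neighbours need not share is the free parameter `x`; the family
-- contains one set for each of its values.
setH setV : ℕ → ℕ → ℕ → ℕ → ℕ → ℕ → Triple
setH K i j u v x = p₁ i (next K j) u x , q₁ i j u v , tʰ i j
setV K i j u v x = p₂ (next K i) j x v , q₂ i j u v , tᵛ i j

allowed : (ℕ → ℕ → Bool) → ℕ → ℕ → ℕ → ℕ → Bool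
allowed adj i j u v = if i ≡ᵇ j then u ≡ᵇ v else adj u v

grid : {A : Set} → ℕ → (ℕ → ℕ → List A) → List A
grid m h = concatMap (λ i → concatMap (λ j → h i j) (downFrom m)) (downFrom m)

ports : ℕ → ℕ → ℕ → ℕ → List Elem
ports i j u v = p₀ i j u v ∷ p₁ i j u v ∷ p₂ i j u v ∷ q₀ i j u v ∷ q₁ i j u v ∷ q₂ i j u v ∷ []

cellElems : ℕ → ℕ → ℕ → List Elem
cellElems n i j = tᵉ i j ∷ tʰ i j ∷ tᵛ i j ∷
  grid n (ports i j)

universe : ℕ → ℕ → List Elem
universe K n = grid K (cellElems n)

wires : ℕ → ℕ → ℕ → ℕ → ℕ → ℕ → List Triple
wires K i j u v x = setH K i j u v x ∷ setV K i j u v x ∷ []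

pairSets : (ℕ → ℕ → Bool) → ℕ → ℕ → ℕ → ℕ → ℕ → ℕ → List Triple
pairSets adj K n i j u v = setP i j u v ∷ setQ i j u v ∷
  (if allowed adj i j u v then setE i j u v ∷ [] else []) ++
  concatMap (wires K i j u v) (downFrom n)

cellSets : (ℕ → ℕ → Bool) → ℕ → ℕ → ℕ → ℕ → List Triple
cellSets adj K n i j =
  (if not ((i ≡ᵇ 0) ∧ (j ≡ᵇ 0)) then setT i j ∷ [] else []) ++
  grid n (pairSets adj K n i j)

family : (ℕ → ℕ → Bool) → ℕ → ℕ → List Triple
family adj K n = grid K (cellSets adj K n)

-- The default sets P, Q, T are those whose first two tags are consecutive.
isDefault : Triple → Bool
isDefault ((s , _) , (t , _) , _) = t ≡ᵇ suc s

sameElem : Elem → Elem → Bool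
sameElem (t , i , j , u , v) (t′ , i′ , j′ , u′ , v′) =
  (t ≡ᵇ t′) ∧ (i ≡ᵇ i′) ∧ (j ≡ᵇ j′) ∧ (u ≡ᵇ u′) ∧ (v ≡ᵇ v′)

mem : Elem → Triple → Bool
mem x (a , b , c) = sameElem x a ∨ sameElem x b ∨ sameElem x c

RawInstance : Set
RawInstance = List Bool × List (List Bool) × List (List Bool)

RawOutput : Set
RawOutput = ℕ × List (List Bool) × List Bool

-- Colors are compared by their binary codes and never decoded, which is sound because the code is
-- injective.
rawAdj : List (List Bool) × List (List Bool) → ℕ → ℕ → Bool
rawAdj (cols , rows) u v =
  nth false (nth [] rows u) v ∧ not (eqBits (nth [] cols u) (nth [] cols v))

rawK : RawInstance → ℕ
rawK (kb , cols , rows) = cappedValue (suc (length cols)) kb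

tables : List Elem → List Triple → RawOutput
tables us ts = length us , map (λ t → map (λ x → mem x t) us) ts , map isDefault ts

rawReduction : RawInstance → RawOutput
rawReduction I@(_ , cols , rows) = let K = rawK I; n = length cols in
  tables (universe K n) (family (rawAdj (cols , rows)) K n)

-- Programs for the reduction

up : ∀ {a b c f} → Poly a b f → Poly (a ⊗ c) b (λ x → f (proj₁ x))
up F = F ∘ₚ fstₚ

-- De Bruijn variables: every nested `concatMapₚ` or `mapₚ` appends its loop variable on the right
-- of the context, so `v₀` is the innermost one.
v₀ : ∀ {a b} → Poly (a ⊗ b) b proj₂
v₀ = sndₚ

v₁ : ∀ {a b c} → Poly ((a ⊗ b) ⊗ c) b (λ x → proj₂ (proj₁ x))
v₁ = up v₀

v₂ : ∀ {a b c d} → Poly (((a ⊗ b) ⊗ c) ⊗ d) b (λ x → proj₂ (proj₁ (proj₁ x)))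
v₂ = up v₁

v₃ : ∀ {a b c d f} → Poly ((((a ⊗ b) ⊗ c) ⊗ d) ⊗ f) b (λ x → proj₂ (proj₁ (proj₁ (proj₁ x))))
v₃ = up v₂

v₄ : ∀ {a b c d f g} → Poly (((((a ⊗ b) ⊗ c) ⊗ d) ⊗ f) ⊗ g) b (λ x → proj₂ (proj₁ (proj₁ (proj₁ (proj₁ x)))))
v₄ = up v₃

elem triple graph ctx rawInstance rawOutput : Ty
elem        = nat ⊗ nat ⊗ nat ⊗ nat ⊗ nat
triple      = elem ⊗ elem ⊗ elem
graph       = list (list bool) ⊗ list (list bool)
ctx         = graph ⊗ nat ⊗ nat
rawInstance = list bool ⊗ graph
rawOutput   = nat ⊗ list (list bool) ⊗ list bool

module _ {a : Ty} {i j : ⟦ a ⟧ → ℕ} (I : Poly a nat i) (J : Poly a nat j) where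

  elemₚ : ∀ {u v} t → Poly a nat u → Poly a nat v → Poly a elem (λ x → t , i x , j x , u x , v x)
  elemₚ t U V = constₚ t ,ₚ I ,ₚ J ,ₚ U ,ₚ V

  setTₚ : Poly a triple (λ x → setT (i x) (j x))
  setTₚ = elemₚ 6 zeroₚ zeroₚ ,ₚ elemₚ 7 zeroₚ zeroₚ ,ₚ elemₚ 8 zeroₚ zeroₚ

nextₚ : ∀ {a k j} → Poly a nat k → Poly a nat j → Poly a nat (λ x → next (k x) (j x))
nextₚ K J = ifₚ (sucₚ J ≡ₚ K) zeroₚ (sucₚ J)

universeₚ : Poly ctx (list elem) (λ (_ , K , n) → universe K n)
universeₚ =
  concatMapₚ range (concatMapₚ (up range)
    (elemₚ v₁ v₀ 6 zeroₚ zeroₚ ∷ₚ elemₚ v₁ v₀ 7 zeroₚ zeroₚ ∷ₚ elemₚ v₁ v₀ 8 zeroₚ zeroₚ ∷ₚ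
     concatMapₚ (up (up vertices)) (concatMapₚ (up (up (up vertices)))
       (at 0 ∷ₚ at 1 ∷ₚ at 2 ∷ₚ at 3 ∷ₚ at 4 ∷ₚ at 5 ∷ₚ []ₚ))))
  where
  range : Poly ctx (list nat) (λ (_ , K , n) → downFrom K)
  range = downFromₚ (fstₚ ∘ₚ sndₚ)
  vertices : Poly ctx (list nat) (λ (_ , K , n) → downFrom n)
  vertices = downFromₚ (sndₚ ∘ₚ sndₚ)
  at : ∀ t → Poly ((((ctx ⊗ nat) ⊗ nat) ⊗ nat) ⊗ nat) elem
                  (λ ((((_ , i) , j) , u) , v) → t , i , j , u , v)
  at t = elemₚ v₃ v₂ t v₁ v₀

rawAdjₚ : ∀ {a g u v} → Poly a graph g → Poly a nat u → Poly a nat v →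
          Poly a bool (λ x → rawAdj (g x) (u x) (v x))
rawAdjₚ G U V =
  nthₚ false refl (nthₚ [] refl (sndₚ ∘ₚ G) U) V ∧ₚ
  notₚ (eqBitsₚ (nthₚ [] refl (fstₚ ∘ₚ G) U) (nthₚ [] refl (fstₚ ∘ₚ G) V))

familyₚ : Poly ctx (list triple) (λ (g , K , n) → family (rawAdj g) K n)
familyₚ =
  concatMapₚ range (concatMapₚ (up range)
    (ifₚ (notₚ (v₁ ≡ₚ zeroₚ ∧ₚ v₀ ≡ₚ zeroₚ)) (setTₚ v₁ v₀ ∷ₚ []ₚ) []ₚ ++ₚ
     concatMapₚ (up (up vertices)) (concatMapₚ (up (up (up vertices)))
       ((at 0 ,ₚ at 1 ,ₚ at 2) ∷ₚ (at 3 ,ₚ at 4 ,ₚ at 5) ∷ₚ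
        (ifₚ allowedₚ ((at 0 ,ₚ at 3 ,ₚ elemₚ v₃ v₂ 6 zeroₚ zeroₚ) ∷ₚ []ₚ) []ₚ ++ₚ
         concatMapₚ (up (up (up (up vertices))))
           ((elemₚ v₄ (nextₚ K v₃) 1 v₂ v₀ ,ₚ up (at 4) ,ₚ elemₚ v₄ v₃ 7 zeroₚ zeroₚ) ∷ₚ
            (elemₚ (nextₚ K v₄) v₃ 2 v₀ v₁ ,ₚ up (at 5) ,ₚ elemₚ v₄ v₃ 8 zeroₚ zeroₚ) ∷ₚ []ₚ))))))
  where
  range : Poly ctx (list nat) (λ (_ , K , n) → downFrom K)
  range = downFromₚ (fstₚ ∘ₚ sndₚ)
  vertices : Poly ctx (list nat) (λ (_ , K , n) → downFrom n)
  vertices = downFromₚ (sndₚ ∘ₚ sndₚ)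
  cell : Ty
  cell = (((ctx ⊗ nat) ⊗ nat) ⊗ nat) ⊗ nat
  at : ∀ t → Poly cell elem (λ ((((_ , i) , j) , u) , v) → t , i , j , u , v)
  at t = elemₚ v₃ v₂ t v₁ v₀
  K : Poly (cell ⊗ nat) nat (λ x → proj₁ (proj₂ (proj₁ (proj₁ (proj₁ (proj₁ (proj₁ x)))))))
  K = up (up (up (up (up (fstₚ ∘ₚ sndₚ)))))
  allowedₚ : Poly cell bool (λ ((((c , i) , j) , u) , v) → allowed (rawAdj (proj₁ c)) i j u v)
  allowedₚ = ifₚ (v₃ ≡ₚ v₂) (v₁ ≡ₚ v₀) (rawAdjₚ (up (up (up (up fstₚ)))) v₁ v₀)

sameElemₚ : Poly (elem ⊗ elem) bool (λ (x , y) → sameElem x y)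
sameElemₚ = (L fstₚ ≡ₚ R fstₚ) ∧ₚ (L (fstₚ ∘ₚ sndₚ) ≡ₚ R (fstₚ ∘ₚ sndₚ)) ∧ₚ
  (L (fstₚ ∘ₚ sndₚ ∘ₚ sndₚ) ≡ₚ R (fstₚ ∘ₚ sndₚ ∘ₚ sndₚ)) ∧ₚ
  (L (fstₚ ∘ₚ sndₚ ∘ₚ sndₚ ∘ₚ sndₚ) ≡ₚ R (fstₚ ∘ₚ sndₚ ∘ₚ sndₚ ∘ₚ sndₚ)) ∧ₚ
  (L (sndₚ ∘ₚ sndₚ ∘ₚ sndₚ ∘ₚ sndₚ) ≡ₚ R (sndₚ ∘ₚ sndₚ ∘ₚ sndₚ ∘ₚ sndₚ))
  where
  L : ∀ {f} → Poly elem nat f → Poly (elem ⊗ elem) nat (λ x → f (proj₁ x))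
  L F = F ∘ₚ fstₚ
  R : ∀ {f} → Poly elem nat f → Poly (elem ⊗ elem) nat (λ x → f (proj₂ x))
  R F = F ∘ₚ sndₚ

memₚ : Poly (triple ⊗ elem) bool (λ (t , x) → mem x t)
memₚ = sameElemₚ ∘ₚ (sndₚ ,ₚ fstₚ ∘ₚ fstₚ) ∨ₚ sameElemₚ ∘ₚ (sndₚ ,ₚ fstₚ ∘ₚ sndₚ ∘ₚ fstₚ) ∨ₚ
       sameElemₚ ∘ₚ (sndₚ ,ₚ sndₚ ∘ₚ sndₚ ∘ₚ fstₚ)

tablesₚ : Poly (list elem ⊗ list triple) rawOutput (λ (us , ts) → tables us ts)
tablesₚ = lengthₚ fstₚ
  ,ₚ mapₚ sndₚ (mapₚ (fstₚ ∘ₚ fstₚ) (memₚ ∘ₚ (v₁ ,ₚ v₀)))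
  ,ₚ mapₚ sndₚ (isDefaultₚ ∘ₚ sndₚ)
  where
  isDefaultₚ : Poly triple bool isDefault
  isDefaultₚ = (fstₚ ∘ₚ fstₚ ∘ₚ sndₚ) ≡ₚ sucₚ (fstₚ ∘ₚ fstₚ)

-- Every step ends by taking the minimum with the cap. The unary accumulator therefore stays small
-- even if the number written in binary is exponentially large.
cappedValueₚ : ∀ {a c ds} → Poly a nat c → Poly a (list bool) ds →
               Poly a nat (λ x → cappedValue (c x) (ds x))
cappedValueₚ {c = c} C D = foldₚ (reverseₚ D) zeroₚ
  (up (up C) ⊓ₚ (v₁ +ₚ (v₁ +ₚ ifₚ v₀ (constₚ 1) (constₚ 2)))) (bnd C)
  (λ x _ u → u ≤ c x)
  (λ x → z≤n)
  (λ x y ys u _ → m⊓n≤m (c x) _)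
  (λ x _ u le → ≤-trans (sz-nat-mono le) (sz-bnd C x))

rawReductionₚ : Poly rawInstance rawOutput rawReduction
rawReductionₚ = tablesₚ ∘ₚ (universeₚ ,ₚ familyₚ) ∘ₚ
  (sndₚ ,ₚ cappedValueₚ (sucₚ n) fstₚ ,ₚ n)
  where
  n : Poly rawInstance nat (λ (_ , cols , _) → length cols)
  n = lengthₚ (fstₚ ∘ₚ sndₚ)

-- Packings of triples

lookup-injective : {xs : List A} → Unique xs → Injective _≡_ _≡_ (lookup xs)
lookup-injective (_ ∷ _) {zero}  {zero}  eq = refl
lookup-injective (x∉ ∷ _) {zero}  {suc j} eq = contradiction eq (All.lookup x∉ (∈-lookup j))
lookup-injective (x∉ ∷ _) {suc i} {zero}  eq = contradiction (sym eq) (All.lookup x∉ (∈-lookup i))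
lookup-injective (_ ∷ u) {suc i} {suc j} eq = cong suc (lookup-injective u eq)

-- Sending a position in `xs` to the position of the same entry in `ys` is injective.
⊆-length : {xs ys : List A} → Unique xs → xs ⊆ ys → length xs ≤ length ys
⊆-length {xs = xs} {ys} u xs⊆ys = Fin.injective⇒≤ {f = λ i → index (xs⊆ys (∈-lookup i))} λ {i} {j} eq →
  lookup-injective u (trans (lookup-index (xs⊆ys (∈-lookup i)))
    (trans (cong (lookup ys) eq) (sym (lookup-index (xs⊆ys (∈-lookup j))))))

module _ (_≟_ : DecidableEquality A) where
  open DecMembership _≟_ using (_∈?_)

  -- An entry `y` missing from `xs` could be added to it, giving a list without repetition inside
  -- `ys` that is longer than `ys`.
  ⊆-length-⊇ : {xs ys : List A} → Unique xs → xs ⊆ ys → length ys ≤ length xs → ys ⊆ xs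
  ⊆-length-⊇ {xs} {ys} u xs⊆ys le {y} y∈ys with y ∈? xs
  ... | yes y∈xs = y∈xs
  ... | no  y∉xs = contradiction
    (⊆-length {xs = y ∷ xs} {ys} (All.tabulate (λ { z∈xs refl → y∉xs z∈xs }) ∷ u)
      (λ { (here refl) → y∈ys ; (there z∈) → xs⊆ys z∈ }))
    (<⇒≱ (s≤s le))

∈-for⁺ : ∀ {h : A → List B} {xs x y} → x ∈ xs → y ∈ h x → y ∈ concatMap h xs
∈-for⁺ {h = h} x∈xs y∈hx = ∈-concatMap⁺ h (lose x∈xs y∈hx)

∈-for⁻ : ∀ {h : A → List B} {xs y} → y ∈ concatMap h xs → ∃[ x ] (x ∈ xs × y ∈ h x)
∈-for⁻ {h = h} y∈ = find (∈-concatMap⁻ h y∈)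

unique-concatMap : ∀ {h : A → List B} {xs} → Unique xs → (∀ x → Unique (h x)) →
  (∀ {x x′ y} → x ∈ xs → x′ ∈ xs → y ∈ h x → y ∈ h x′ → x ≡ x′) → Unique (concatMap h xs)
unique-concatMap [] uh disj = []
unique-concatMap {h = h} (x∉ ∷ u) uh disj = Unique.++⁺ (uh _)
  (unique-concatMap u uh λ p q → disj (there p) (there q))
  λ (y∈ , y∈′) → let x′ , x′∈ , y∈x′ = ∈-for⁻ {h = h} y∈′
                 in All.lookup x∉ x′∈ (disj (here refl) (there x′∈) y∈ y∈x′)

length-concatMap : ∀ {h : A → List B} c xs → (∀ x → length (h x) ≡ c) → length (concatMap h xs) ≡ length xs * c
length-concatMap c [] eq = refl
length-concatMap {h = h} c (x ∷ xs) eq = trans (length-++ (h x)) (cong₂ _+_ (eq x) (length-concatMap c xs eq))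

members : ∀ {n} → Subset n → List (Fin n)
members []          = []
members (true ∷ p)  = zero ∷ map suc (members p)
members (false ∷ p) = map suc (members p)

length-members : ∀ {n} (p : Subset n) → length (members p) ≡ ∣ p ∣
length-members []          = refl
length-members (true ∷ p)  = cong suc (trans (length-map suc (members p)) (length-members p))
length-members (false ∷ p) = trans (length-map suc (members p)) (length-members p)

∈-members⁺ : ∀ {n i} {p : Subset n} → i ∈ₛ p → i ∈ members p
∈-members⁺ here = here refl
∈-members⁺ {p = true  ∷ p} (there i∈p) = there (∈-map⁺ suc (∈-members⁺ i∈p))
∈-members⁺ {p = false ∷ p} (there i∈p) = ∈-map⁺ suc (∈-members⁺ i∈p)

∈-members⁻ : ∀ {n i} (p : Subset n) → i ∈ members p → i ∈ₛ p
∈-members⁻ (true  ∷ p) (here refl) = here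
∈-members⁻ (true  ∷ p) (there i∈) with _ , j∈ , refl ← ∈-map⁻ suc i∈ = there (∈-members⁻ p j∈)
∈-members⁻ (false ∷ p) i∈ with _ , j∈ , refl ← ∈-map⁻ suc i∈ = there (∈-members⁻ p j∈)

unique-members : ∀ {n} (p : Subset n) → Unique (members p)
unique-members []          = []
unique-members (true  ∷ p) = All.tabulate (λ i∈ eq → case-zero (subst (_∈ _) (sym eq) i∈)) ∷ Unique.map⁺ Fin.suc-injective (unique-members p)
  where
  case-zero : ∀ {xs} → Fin.zero ∈ map suc xs → ⊥
  case-zero 0∈ with _ , _ , () ← ∈-map⁻ suc 0∈
unique-members (false ∷ p) = Unique.map⁺ Fin.suc-injective (unique-members p)

card-≤ : {xs ys : List A} → Unique xs → (p : Subset (length xs)) →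
         (∀ {i} → i ∈ₛ p → lookup xs i ∈ ys) → ∣ p ∣ ≤ length ys
card-≤ {xs = xs} {ys} u p p⊆ys = subst (_≤ length ys)
  (trans (length-map (lookup xs) (members p)) (length-members p))
  (⊆-length (Unique.map⁺ (lookup-injective u) (unique-members p)) λ x∈ →
    let i , i∈ , eq = ∈-map⁻ (lookup xs) x∈ in subst (_∈ ys) (sym eq) (p⊆ys (∈-members⁻ p i∈)))

card-≥ : {xs ys : List A} (p : Subset (length xs)) → Unique ys →
         (∀ {y} → y ∈ ys → ∃[ i ] (i ∈ₛ p × lookup xs i ≡ y)) → length ys ≤ ∣ p ∣
card-≥ {xs = xs} {ys} p u ys⊆p = subst (length ys ≤_)
  (trans (length-map (lookup xs) (members p)) (length-members p))
  (⊆-length u λ y∈ → let i , i∈p , eq = ys⊆p y∈ in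
    subst (_∈ map (lookup xs) (members p)) eq (∈-map⁺ (lookup xs) (∈-members⁺ i∈p)))

-- Both sides count the union.
∣p─q∣+∣q∣ : ∀ {n} (p q : Subset n) → ∣ p ─ q ∣ + ∣ q ∣ ≡ ∣ q ─ p ∣ + ∣ p ∣
∣p─q∣+∣q∣ [] [] = refl
∣p─q∣+∣q∣ (true  ∷ p) (true  ∷ q) = trans (+-suc ∣ p ─ q ∣ ∣ q ∣) (trans (cong suc (∣p─q∣+∣q∣ p q)) (sym (+-suc ∣ q ─ p ∣ ∣ p ∣)))
∣p─q∣+∣q∣ (true  ∷ p) (false ∷ q) = trans (cong suc (∣p─q∣+∣q∣ p q)) (sym (+-suc ∣ q ─ p ∣ ∣ p ∣))
∣p─q∣+∣q∣ (false ∷ p) (true  ∷ q) = trans (+-suc ∣ p ─ q ∣ ∣ q ∣) (cong suc (∣p─q∣+∣q∣ p q))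
∣p─q∣+∣q∣ (false ∷ p) (false ∷ q) = ∣p─q∣+∣q∣ p q

∈-tabulate⁺ : ∀ {n} {b : Fin n → Bool} {i} → T (b i) → i ∈ₛ Vec.tabulate b
∈-tabulate⁺ {b = b} {i} bi = lookup⇒[]= i _ (trans (lookup∘tabulate b i) (Equivalence.to T-≡ bi))

∈-tabulate⁻ : ∀ {n} {b : Fin n → Bool} {i} → i ∈ₛ Vec.tabulate b → T (b i)
∈-tabulate⁻ {b = b} {i} i∈ = Equivalence.from T-≡ (trans (sym (lookup∘tabulate b i)) ([]=⇒lookup i∈))

_≟ₑ_ : DecidableEquality Elem
_≟ₑ_ = ≡-dec _≟_ (≡-dec _≟_ (≡-dec _≟_ (≡-dec _≟_ _≟_)))

_≟ₜ_ : DecidableEquality Triple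
_≟ₜ_ = ≡-dec _≟ₑ_ (≡-dec _≟ₑ_ _≟ₑ_)

elems : Triple → List Elem
elems (a , b , c) = a ∷ b ∷ c ∷ []

sameElem-sound : ∀ x y → T (sameElem x y) → x ≡ y
sameElem-sound (t , i , j , u , v) (t′ , i′ , j′ , u′ , v′) p =
  let e₁ , p = Equivalence.to (T-∧ {t ≡ᵇ t′}) p
      e₂ , p = Equivalence.to (T-∧ {i ≡ᵇ i′}) p
      e₃ , p = Equivalence.to (T-∧ {j ≡ᵇ j′}) p
      e₄ , e₅ = Equivalence.to (T-∧ {u ≡ᵇ u′}) p
  in cong₂ _,_ (≡ᵇ⇒≡ t t′ e₁) (cong₂ _,_ (≡ᵇ⇒≡ i i′ e₂) (cong₂ _,_ (≡ᵇ⇒≡ j j′ e₃)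
       (cong₂ _,_ (≡ᵇ⇒≡ u u′ e₄) (≡ᵇ⇒≡ v v′ e₅))))

sameElem-refl : ∀ x → T (sameElem x x)
sameElem-refl (t , i , j , u , v) =
  Equivalence.from T-∧ (≡⇒≡ᵇ t t refl , Equivalence.from T-∧ (≡⇒≡ᵇ i i refl ,
  Equivalence.from T-∧ (≡⇒≡ᵇ j j refl , Equivalence.from T-∧ (≡⇒≡ᵇ u u refl , ≡⇒≡ᵇ v v refl))))

mem⁻ : ∀ x t → T (mem x t) → x ∈ elems t
mem⁻ x (a , b , c) p with Equivalence.to (T-∨ {sameElem x a}) p
... | inj₁ q = here (sameElem-sound x a q)
... | inj₂ p′ with Equivalence.to (T-∨ {sameElem x b}) p′
...   | inj₁ q = there (here (sameElem-sound x b q))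
...   | inj₂ q = there (there (here (sameElem-sound x c q)))

mem⁺ : ∀ x t → x ∈ elems t → T (mem x t)
mem⁺ x (a , b , c) (here refl) = Equivalence.from T-∨ (inj₁ (sameElem-refl x))
mem⁺ x (a , b , c) (there (here refl)) = Equivalence.from (T-∨ {sameElem x a}) (inj₂ (Equivalence.from T-∨ (inj₁ (sameElem-refl x))))
mem⁺ x (a , b , c) (there (there (here refl))) = Equivalence.from (T-∨ {sameElem x a}) (inj₂
  (Equivalence.from (T-∨ {sameElem x b}) (inj₂ (sameElem-refl x))))

tag : Elem → ℕ
tag = proj₁

-- All sets of the construction list their elements in this order. It makes the three elements
-- distinct and lets a triple be recovered from its underlying set, so that different triples have
-- different characteristic vectors.
Increasing : Triple → Set
Increasing (a , b , c) = tag a < tag b × tag b < tag c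

unique-elems : ∀ t → Increasing t → Unique (elems t)
unique-elems (a , b , c) (a<b , b<c) =
  ((λ { refl → <-irrefl refl a<b }) ∷ (λ { refl → <-asym a<b b<c }) ∷ []) ∷
  ((λ { refl → <-irrefl refl b<c }) ∷ []) ∷ [] ∷ []

-- The first entry has the smallest tag of the set and the last one the largest, so the set
-- determines both; the middle entry is the one that remains.
elems-injective : ∀ s t → Increasing s → Increasing t → elems s ⊆ elems t → elems t ⊆ elems s → s ≡ t
elems-injective (a , b , c) (a′ , b′ , c′) (a<b , b<c) (a′<b′ , b′<c′) s⊆t t⊆s =
  cong₂ _,_ a≡a′ (cong₂ _,_ b≡b′ c≡c′)
  where
  a≤ : ∀ {x} → x ∈ elems (a , b , c) → tag a ≤ tag x
  a≤ (here refl) = ≤-refl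
  a≤ (there (here refl)) = <⇒≤ a<b
  a≤ (there (there (here refl))) = <⇒≤ (<-trans a<b b<c)

  ≤c : ∀ {x} → x ∈ elems (a , b , c) → tag x ≤ tag c
  ≤c (here refl) = <⇒≤ (<-trans a<b b<c)
  ≤c (there (here refl)) = <⇒≤ b<c
  ≤c (there (there (here refl))) = ≤-refl

  a≡a′ : a ≡ a′
  a≡a′ with s⊆t (here refl)
  ... | here eq = eq
  ... | there (here refl) = contradiction a′<b′ (≤⇒≯ (a≤ (t⊆s (here refl))))
  ... | there (there (here refl)) = contradiction (<-trans a′<b′ b′<c′) (≤⇒≯ (a≤ (t⊆s (here refl))))

  c≡c′ : c ≡ c′
  c≡c′ with s⊆t (there (there (here refl)))
  ... | there (there (here eq)) = eq
  ... | there (here refl) = contradiction b′<c′ (≤⇒≯ (≤c (t⊆s (there (there (here refl))))))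
  ... | here refl = contradiction (<-trans a′<b′ b′<c′) (≤⇒≯ (≤c (t⊆s (there (there (here refl))))))

  b≡b′ : b ≡ b′
  b≡b′ with s⊆t (there (here refl))
  ... | there (here eq) = eq
  ... | here refl = contradiction a<b (<-irrefl (cong tag a≡a′))
  ... | there (there (here refl)) = contradiction b<c (<-irrefl (sym (cong tag c≡c′)))

-- The set system given by lists of elements and triples

system : List Elem → List Triple → SetSystem
system us ts = record
  { m  = length us
  ; N  = length ts
  ; 𝓕  = Vec.tabulate λ i → Vec.tabulate λ x → mem (lookup us x) (lookup ts i)
  ; 𝓕₀ = Vec.tabulate λ i → isDefault (lookup ts i)
  }

record WellFormed (us : List Elem) (ts : List Triple) : Set where
  field
    us-unique  : Unique us
    ts-unique  : Unique ts
    increasing : ∀ {t} → t ∈ ts → Increasing t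
    ts⊆us      : ∀ {t} → t ∈ ts → elems t ⊆ us

module _ {us ts} (wf : WellFormed us ts) where
  open WellFormed wf
  𝒮 : SetSystem
  𝒮 = system us ts

  open SetSystem 𝒮

  ∈-𝓕⁺ : ∀ {x i} → lookup us x ∈ elems (lookup ts i) → x ∈ₛ Vec.lookup 𝓕 i
  ∈-𝓕⁺ {x} {i} x∈ = subst (x ∈ₛ_) (sym (lookup∘tabulate _ i)) (∈-tabulate⁺ (mem⁺ _ (lookup ts i) x∈))

  ∈-𝓕⁻ : ∀ {x i} → x ∈ₛ Vec.lookup 𝓕 i → lookup us x ∈ elems (lookup ts i)
  ∈-𝓕⁻ {x} {i} x∈ = mem⁻ _ (lookup ts i) (∈-tabulate⁻ (subst (x ∈ₛ_) (lookup∘tabulate _ i) x∈))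

  elems⊆us : ∀ i → elems (lookup ts i) ⊆ us
  elems⊆us i = ts⊆us (∈-lookup i)

  position : ∀ {x} → x ∈ us → ∃[ k ] lookup us k ≡ x
  position x∈us = index x∈us , sym (lookup-index x∈us)

  elems-unique : ∀ i → Unique (elems (lookup ts i))
  elems-unique i = unique-elems _ (increasing (∈-lookup i))

  𝓕-triples : ∀ i → ∣ Vec.lookup 𝓕 i ∣ ≡ 3
  𝓕-triples i = ≤-antisym
    (card-≤ us-unique (Vec.lookup 𝓕 i) ∈-𝓕⁻)
    (card-≥ {xs = us} (Vec.lookup 𝓕 i) (elems-unique i) λ {x} x∈ → let k , eq = position (elems⊆us i x∈)
      in k , ∈-𝓕⁺ (subst (_∈ elems (lookup ts i)) (sym eq) x∈) , eq)

  𝓕-injective : Injective _≡_ _≡_ (Vec.lookup 𝓕)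
  𝓕-injective {i} {j} eq = lookup-injective ts-unique
    (elems-injective _ _ (increasing (∈-lookup i)) (increasing (∈-lookup j)) (sub i j eq) (sub j i (sym eq)))
    where
    sub : ∀ i j → Vec.lookup 𝓕 i ≡ Vec.lookup 𝓕 j → elems (lookup ts i) ⊆ elems (lookup ts j)
    sub i j eq x∈ = let k , e = position (elems⊆us i x∈) in
      subst (_∈ elems (lookup ts j)) e (∈-𝓕⁻ (subst (k ∈ₛ_) eq (∈-𝓕⁺ (subst (_∈ elems (lookup ts i)) (sym e) x∈))))

  disjoint⇒≡ : ∀ {G} → PairwiseDisjoint 𝒮 G → ∀ {i j x} → i ∈ₛ G → j ∈ₛ G →
               x ∈ elems (lookup ts i) → x ∈ elems (lookup ts j) → i ≡ j
  disjoint⇒≡ disj {i} {j} i∈ j∈ x∈i x∈j with i Fin.≟ j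
  ... | yes eq = eq
  ... | no neq with k , refl ← position (elems⊆us i x∈i) =
    ⊥-elim (disj i∈ j∈ neq (k , x∈p∩q⁺ (∈-𝓕⁺ x∈i , ∈-𝓕⁺ x∈j)))

  covered : Subset N → List Elem
  covered G = concatMap (λ i → elems (lookup ts i)) (members G)

  ∈-covered⁻ : ∀ {x} G → x ∈ covered G → ∃[ i ] (i ∈ₛ G × x ∈ elems (lookup ts i))
  ∈-covered⁻ G x∈ = let i , i∈ , x∈i = ∈-for⁻ {xs = members G} x∈ in i , ∈-members⁻ G i∈ , x∈i

  ∈-covered⁺ : ∀ {x i} G → i ∈ₛ G → x ∈ elems (lookup ts i) → x ∈ covered G
  ∈-covered⁺ G i∈ = ∈-for⁺ {xs = members G} (∈-members⁺ i∈)

  length-covered : ∀ G → length (covered G) ≡ ∣ G ∣ * 3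
  length-covered G = trans (length-concatMap 3 (members G) λ _ → refl) (cong (_* 3) (length-members G))

  unique-covered : ∀ {G} → PairwiseDisjoint 𝒮 G → Unique (covered G)
  unique-covered {G} disj = unique-concatMap (unique-members G) elems-unique λ i∈ j∈ →
    disjoint⇒≡ disj (∈-members⁻ G i∈) (∈-members⁻ G j∈)

  covered⊆us : ∀ G → covered G ⊆ us
  covered⊆us G x∈ = let i , _ , x∈i = ∈-covered⁻ G x∈ in elems⊆us i x∈i

  -- Disjoint triples, a third as many as there are elements, cover as many elements as the universe
  -- has; divisibility by 3 makes this count exact.
  perfect-covers : ∀ {G} → 3 ∣ length us → IsPerfectPacking 𝒮 G → ∀ {x} → x ∈ us →
                   ∃[ i ] (i ∈ₛ G × x ∈ elems (lookup ts i))
  perfect-covers {G} 3∣m (disj , card) x∈us =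
    ∈-covered⁻ G (⊆-length-⊇ _≟ₑ_ (unique-covered disj) (covered⊆us G)
      (≤-reflexive (sym (trans (length-covered G) (trans (cong (_* 3) card) (m/n*n≡m 3∣m))))) x∈us)

  chosen : (Triple → Bool) → Subset N
  chosen χ = Vec.tabulate (χ ∘ lookup ts)

  -- The chosen triples form a packing because own x is the only one that can contain x.
  module _ (χ : Triple → Bool) (own : Elem → Triple)
           (own-≡ : ∀ {t x} → t ∈ ts → T (χ t) → x ∈ elems t → own x ≡ t) where

    chosen-disjoint : PairwiseDisjoint 𝒮 (chosen χ)
    chosen-disjoint {i} {j} i∈ j∈ i≢j (k , k∈) =
      let k∈i , k∈j = x∈p∩q⁻ _ _ k∈ in
      i≢j (lookup-injective ts-unique (trans
        (sym (own-≡ (∈-lookup i) (∈-tabulate⁻ i∈) (∈-𝓕⁻ k∈i)))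
        (own-≡ (∈-lookup j) (∈-tabulate⁻ j∈) (∈-𝓕⁻ k∈j))))

    -- The universe splits into the elements of the chosen triples and `rest`. The default packing
    -- uses this with the three elements that it leaves uncovered, the packing built from a clique
    -- with `[]`.
    chosen-card : (rest : List Elem) → Unique rest → rest ⊆ us →
      (∀ {t x} → t ∈ ts → T (χ t) → x ∈ elems t → x ∉ rest) →
      (∀ {x} → x ∈ us → x ∈ rest ⊎ (own x ∈ ts × T (χ (own x)) × x ∈ elems (own x))) →
      length us ≡ ∣ chosen χ ∣ * 3 + length rest
    chosen-card rest u rest⊆us avoid cover = trans (≤-antisym
        (⊆-length us-unique λ x∈us → [ ∈-++⁺ʳ (covered (chosen χ)) , (∈-++⁺ˡ ∘ cov) ]′ (cover x∈us))
        (⊆-length (Unique.++⁺ (unique-covered chosen-disjoint) u λ (x∈ , x∈rest) →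
            let i , i∈ , x∈i = ∈-covered⁻ (chosen χ) x∈ in
            avoid (∈-lookup i) (∈-tabulate⁻ i∈) x∈i x∈rest)
          λ x∈ → [ covered⊆us (chosen χ) , rest⊆us ]′ (∈-++⁻ (covered (chosen χ)) x∈)))
      (trans (length-++ (covered (chosen χ))) (cong (_+ length rest) (length-covered (chosen χ))))
      where
      cov : ∀ {x} → own x ∈ ts × T (χ (own x)) × x ∈ elems (own x) → x ∈ covered (chosen χ)
      cov {x} (o∈ , χo , x∈) = ∈-covered⁺ (chosen χ) (∈-tabulate⁺ (subst (T ∘ χ) eq χo))
        (subst (λ t → x ∈ elems t) eq x∈)
        where eq = lookup-index o∈

-- The sets and elements of the torus

all-concatMap : ∀ {P : B → Set} {h : A → List B} xs → (∀ x → All P (h x)) → All P (concatMap h xs)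
all-concatMap []       ph = []
all-concatMap (x ∷ xs) ph = All.++⁺ (ph x) (all-concatMap xs ph)

-- The key recovers from an entry the block that it came from, so different blocks are disjoint.
unique-concatMap-key : ∀ {h : A → List B} {xs} (key : B → A) → Unique xs → (∀ x → Unique (h x)) →
                       (∀ x → All (λ y → key y ≡ x) (h x)) → Unique (concatMap h xs)
unique-concatMap-key key u uh hk = unique-concatMap u uh λ {x} {x′} _ _ y∈ y∈′ →
  trans (sym (All.lookup (hk x) y∈)) (All.lookup (hk x′) y∈′)

prev : ℕ → ℕ → ℕ
prev K zero    = pred K
prev K (suc j) = j

module _ {K : ℕ} where
  prev< : ∀ {j} → j < K → prev K j < K
  prev< {zero}  (s≤s _) = ≤-refl
  prev< {suc j} j<K     = <⇒≤ j<K

  next-suc : ∀ {j} → suc j < K → next K j ≡ suc j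
  next-suc {j} sj<K with suc j ≡ᵇ K in eq
  ... | false = refl
  ... | true  = contradiction (≡ᵇ⇒≡ (suc j) K (Equivalence.from T-≡ eq)) (<⇒≢ sj<K)

  next-prev : ∀ {j} → j < K → next K (prev K j) ≡ j
  next-prev {zero} (s≤s {n = n} _) rewrite Equivalence.to T-≡ (≡⇒≡ᵇ n n refl) = refl
  next-prev {suc j} j<K = next-suc j<K

  next< : ∀ {j} → j < K → next K j < K
  next< {j} j<K with suc j ≡ᵇ K in eq
  ... | true  = ≤-<-trans z≤n j<K
  ... | false = ≤∧≢⇒< j<K λ { refl → subst T eq (≡⇒≡ᵇ (suc j) (suc j) refl) }

  prev-next : ∀ {j} → j < K → prev K (next K j) ≡ j
  prev-next {j} j<K with suc j ≡ᵇ K in eq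
  ... | true  = sym (cong pred (≡ᵇ⇒≡ (suc j) K (Equivalence.from T-≡ eq)))
  ... | false = refl

∈-grid⁺ : ∀ {h : ℕ → ℕ → List A} {m i j y} → i < m → j < m → y ∈ h i j → y ∈ grid m h
∈-grid⁺ {h = h} {m} {i} i<m j<m y∈ =
  ∈-for⁺ {h = λ i → concatMap (h i) (downFrom m)} (∈-downFrom⁺ i<m) (∈-for⁺ {h = h i} (∈-downFrom⁺ j<m) y∈)

∈-grid⁻ : ∀ m (h : ℕ → ℕ → List A) {y} → y ∈ grid m h → ∃[ i ] ∃[ j ] (i < m × j < m × y ∈ h i j)
∈-grid⁻ m h y∈ =
  let i , i∈ , y∈′ = ∈-for⁻ {h = λ i → concatMap (h i) (downFrom m)} {xs = downFrom m} y∈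
      j , j∈ , y∈″ = ∈-for⁻ {h = h i} {xs = downFrom m} y∈′
  in i , j , ∈-downFrom⁻ i∈ , ∈-downFrom⁻ j∈ , y∈″

all-grid : ∀ {P : A → Set} {h : ℕ → ℕ → List A} m → (∀ i j → All P (h i j)) → All P (grid m h)
all-grid m ph = all-concatMap (downFrom m) λ i → all-concatMap (downFrom m) (ph i)

unique-grid : ∀ {h : ℕ → ℕ → List A} m (key₁ key₂ : A → ℕ) → (∀ i j → Unique (h i j)) →
  (∀ i j → All (λ y → key₁ y ≡ i × key₂ y ≡ j) (h i j)) → Unique (grid m h)
unique-grid m key₁ key₂ uh hk = unique-concatMap-key key₁ (Unique.downFrom⁺ m)
  (λ i → unique-concatMap-key key₂ (Unique.downFrom⁺ m) (uh i) λ j → All.map proj₂ (hk i j))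
  λ i → all-concatMap (downFrom m) λ j → All.map proj₁ (hk i j)

∈-if⁺ : ∀ {b} {x : A} → T b → x ∈ (if b then x ∷ [] else [])
∈-if⁺ {b = true} _ = here refl

∈-if⁻ : ∀ b {x y : A} → y ∈ (if b then x ∷ [] else []) → T b × y ≡ x
∈-if⁻ true (here eq) = _ , eq

all-if : ∀ {P : A → Set} b {x} → P x → All P (if b then x ∷ [] else [])
all-if true  px = px ∷ []
all-if false px = []

unique-if : ∀ b {x : A} → Unique (if b then x ∷ [] else [])
unique-if true  = [] ∷ []
unique-if false = []

module Grid (adj : ℕ → ℕ → Bool) (K n : ℕ) where

  -- `IsElem` and `IsSet` restate membership in the nested lists, so that the combinatorial
  -- arguments can proceed by cases on the kind of element or set.
  data IsElem : Elem → Set where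
    isᵉ : ∀ {i j} → i < K → j < K → IsElem (tᵉ i j)
    isʰ : ∀ {i j} → i < K → j < K → IsElem (tʰ i j)
    isᵛ : ∀ {i j} → i < K → j < K → IsElem (tᵛ i j)
    isp₀ : ∀ {i j u v} → i < K → j < K → u < n → v < n → IsElem (p₀ i j u v)
    isp₁ : ∀ {i j u v} → i < K → j < K → u < n → v < n → IsElem (p₁ i j u v)
    isp₂ : ∀ {i j u v} → i < K → j < K → u < n → v < n → IsElem (p₂ i j u v)
    isq₀ : ∀ {i j u v} → i < K → j < K → u < n → v < n → IsElem (q₀ i j u v)
    isq₁ : ∀ {i j u v} → i < K → j < K → u < n → v < n → IsElem (q₁ i j u v)
    isq₂ : ∀ {i j u v} → i < K → j < K → u < n → v < n → IsElem (q₂ i j u v)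

  data IsSet : Triple → Set where
    isT : ∀ {i j} → i < K → j < K → ¬ (i ≡ 0 × j ≡ 0) → IsSet (setT i j)
    isP : ∀ {i j u v} → i < K → j < K → u < n → v < n → IsSet (setP i j u v)
    isQ : ∀ {i j u v} → i < K → j < K → u < n → v < n → IsSet (setQ i j u v)
    isE : ∀ {i j u v} → i < K → j < K → u < n → v < n → T (allowed adj i j u v) → IsSet (setE i j u v)
    isH : ∀ {i j u v x} → i < K → j < K → u < n → v < n → x < n → IsSet (setH K i j u v x)
    isV : ∀ {i j u v x} → i < K → j < K → u < n → v < n → x < n → IsSet (setV K i j u v x)

  U : List Elem
  U = universe K n

  F : List Triple
  F = family adj K n

  U⁻ : ∀ {x} → x ∈ U → IsElem x
  U⁻ x∈ with ∈-grid⁻ K (cellElems n) x∈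
  ... | i , j , i< , j< , here refl = isᵉ i< j<
  ... | i , j , i< , j< , there (here refl) = isʰ i< j<
  ... | i , j , i< , j< , there (there (here refl)) = isᵛ i< j<
  ... | i , j , i< , j< , there (there (there x∈′)) with ∈-grid⁻ n (ports i j) x∈′
  ...   | u , v , u< , v< , here refl = isp₀ i< j< u< v<
  ...   | u , v , u< , v< , there (here refl) = isp₁ i< j< u< v<
  ...   | u , v , u< , v< , there (there (here refl)) = isp₂ i< j< u< v<
  ...   | u , v , u< , v< , there (there (there (here refl))) = isq₀ i< j< u< v<
  ...   | u , v , u< , v< , there (there (there (there (here refl)))) = isq₁ i< j< u< v<
  ...   | u , v , u< , v< , there (there (there (there (there (here refl))))) = isq₂ i< j< u< v<

  port⁺ : ∀ {i j u v x} → i < K → j < K → u < n → v < n → x ∈ ports i j u v → x ∈ U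
  port⁺ {i} {j} i< j< u< v< x∈ = ∈-grid⁺ {h = cellElems n} i< j<
    (there (there (there (∈-grid⁺ {h = ports i j} u< v< x∈))))

  U⁺ : ∀ {x} → IsElem x → x ∈ U
  U⁺ (isᵉ i< j<) = ∈-grid⁺ {h = cellElems n} i< j< (here refl)
  U⁺ (isʰ i< j<) = ∈-grid⁺ {h = cellElems n} i< j< (there (here refl))
  U⁺ (isᵛ i< j<) = ∈-grid⁺ {h = cellElems n} i< j< (there (there (here refl)))
  U⁺ (isp₀ i< j< u< v<) = port⁺ i< j< u< v< (here refl)
  U⁺ (isp₁ i< j< u< v<) = port⁺ i< j< u< v< (there (here refl))
  U⁺ (isp₂ i< j< u< v<) = port⁺ i< j< u< v< (there (there (here refl)))
  U⁺ (isq₀ i< j< u< v<) = port⁺ i< j< u< v< (there (there (there (here refl))))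
  U⁺ (isq₁ i< j< u< v<) = port⁺ i< j< u< v< (there (there (there (there (here refl)))))
  U⁺ (isq₂ i< j< u< v<) = port⁺ i< j< u< v< (there (there (there (there (there (here refl))))))

  unique-U : Unique U
  unique-U = unique-grid K (λ (_ , i , _) → i) (λ (_ , _ , j , _) → j) unique-cell λ i j →
    (refl , refl) ∷ (refl , refl) ∷ (refl , refl) ∷ all-grid n λ u v →
      (refl , refl) ∷ (refl , refl) ∷ (refl , refl) ∷ (refl , refl) ∷ (refl , refl) ∷ (refl , refl) ∷ []
    where
    ports≢ : ∀ {i j t} → 6 ≤ t → ∀ {y} → All ((t , y) ≢_) (grid n (ports i j))
    ports≢ 6≤t = all-grid n λ u v → d 0 6≤t ∷ d 1 6≤t ∷ d 2 6≤t ∷ d 3 6≤t ∷ d 4 6≤t ∷ d 5 6≤t ∷ []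
      where
      d : ∀ s {_ : T (s <ᵇ 6)} {t} {y z : ℕ × ℕ × ℕ × ℕ} → 6 ≤ t → (t , y) ≢ (s , z)
      d s {lt} 6≤t refl = contradiction 6≤t (<⇒≱ (<ᵇ⇒< s 6 lt))

    unique-cell : ∀ i j → Unique (cellElems n i j)
    unique-cell i j =
      ((λ ()) ∷ (λ ()) ∷ ports≢ ≤-refl) ∷ ((λ ()) ∷ ports≢ (n≤1+n 6)) ∷ ports≢ (m≤n+m 6 2) ∷
      unique-grid n (λ (_ , _ , _ , u , _) → u) (λ (_ , _ , _ , _ , v) → v)
        (λ u v → ((λ ()) ∷ (λ ()) ∷ (λ ()) ∷ (λ ()) ∷ (λ ()) ∷ []) ∷ ((λ ()) ∷ (λ ()) ∷ (λ ()) ∷ (λ ()) ∷ []) ∷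
          ((λ ()) ∷ (λ ()) ∷ (λ ()) ∷ []) ∷ ((λ ()) ∷ (λ ()) ∷ []) ∷ ((λ ()) ∷ []) ∷ [] ∷ [])
        λ u v → (refl , refl) ∷ (refl , refl) ∷ (refl , refl) ∷ (refl , refl) ∷ (refl , refl) ∷ (refl , refl) ∷ []

  setE? : ∀ i j u v → List Triple
  setE? i j u v = if allowed adj i j u v then setE i j u v ∷ [] else []

  setT? : ∀ i j → List Triple
  setT? i j = if not ((i ≡ᵇ 0) ∧ (j ≡ᵇ 0)) then setT i j ∷ [] else []

  pairSets⁻ : ∀ {i j u v t} → i < K → j < K → u < n → v < n → t ∈ pairSets adj K n i j u v → IsSet t
  pairSets⁻ i< j< u< v< (here refl) = isP i< j< u< v<
  pairSets⁻ i< j< u< v< (there (here refl)) = isQ i< j< u< v<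
  pairSets⁻ {i} {j} {u} {v} i< j< u< v< (there (there t∈)) with ∈-++⁻ (setE? i j u v) t∈
  ... | inj₁ t∈E with ok , refl ← ∈-if⁻ _ t∈E = isE i< j< u< v< ok
  ... | inj₂ t∈w with ∈-for⁻ {h = wires K i j u v} {xs = downFrom n} t∈w
  ...   | x , x∈ , here refl = isH i< j< u< v< (∈-downFrom⁻ x∈)
  ...   | x , x∈ , there (here refl) = isV i< j< u< v< (∈-downFrom⁻ x∈)

  F⁻ : ∀ {t} → t ∈ F → IsSet t
  F⁻ t∈ with ∈-grid⁻ K (cellSets adj K n) t∈
  ... | i , j , i< , j< , t∈c with ∈-++⁻ (setT? i j) t∈c
  ...   | inj₁ t∈T with ok , refl ← ∈-if⁻ _ t∈T = isT i< j< λ { (refl , refl) → ok }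
  ...   | inj₂ t∈p with u , v , u< , v< , t∈′ ← ∈-grid⁻ n (pairSets adj K n i j) t∈p =
          pairSets⁻ i< j< u< v< t∈′

  pair⁺ : ∀ {i j u v t} → i < K → j < K → u < n → v < n → t ∈ pairSets adj K n i j u v → t ∈ F
  pair⁺ {i} {j} i< j< u< v< t∈ = ∈-grid⁺ {h = cellSets adj K n} i< j<
    (∈-++⁺ʳ (setT? i j) (∈-grid⁺ {h = pairSets adj K n i j} u< v< t∈))

  wire⁺ : ∀ {i j u v x t} → i < K → j < K → u < n → v < n → x < n → t ∈ wires K i j u v x → t ∈ F
  wire⁺ {i} {j} {u} {v} i< j< u< v< x< t∈ = pair⁺ i< j< u< v< (there (there (∈-++⁺ʳ (setE? i j u v)
    (∈-for⁺ {h = wires K i j u v} (∈-downFrom⁺ x<) t∈))))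

  F⁺ : ∀ {t} → IsSet t → t ∈ F
  F⁺ (isT {i} {j} i< j< ≢00) = ∈-grid⁺ {h = cellSets adj K n} i< j< (∈-++⁺ˡ (∈-if⁺ (nonzero i j ≢00)))
    where
    nonzero : ∀ i j → ¬ (i ≡ 0 × j ≡ 0) → T (not ((i ≡ᵇ 0) ∧ (j ≡ᵇ 0)))
    nonzero zero    zero    ≢ = contradiction (refl , refl) ≢
    nonzero zero    (suc j) ≢ = _
    nonzero (suc i) j       ≢ = _
  F⁺ (isP i< j< u< v<) = pair⁺ i< j< u< v< (here refl)
  F⁺ (isQ i< j< u< v<) = pair⁺ i< j< u< v< (there (here refl))
  F⁺ (isE i< j< u< v< ok) = pair⁺ i< j< u< v< (there (there (∈-++⁺ˡ (∈-if⁺ ok))))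
  F⁺ (isH i< j< u< v< x<) = wire⁺ i< j< u< v< x< (here refl)
  F⁺ (isV i< j< u< v< x<) = wire⁺ i< j< u< v< x< (there (here refl))

  -- The keys are read off the second element of a triple. It lies in the set's own cell for every
  -- kind of set and carries the pair `u`, `v` for every kind but T, whereas the first element of H
  -- or V lies in a neighbouring cell.
  unique-F : Unique F
  unique-F = unique-grid K (λ (_ , (_ , i , _) , _) → i) (λ (_ , (_ , _ , j , _) , _) → j)
    (λ i j → Unique.++⁺ (unique-if (not ((i ≡ᵇ 0) ∧ (j ≡ᵇ 0))))
      (unique-grid n (λ (_ , (_ , _ , _ , u , _) , _) → u) (λ (_ , (_ , _ , _ , _ , v) , _) → v)
        (unique-pair i j)
        λ u v → (refl , refl) ∷ (refl , refl) ∷ All.++⁺ (all-if _ (refl , refl))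
          (all-concatMap (downFrom n) λ x → (refl , refl) ∷ (refl , refl) ∷ []))
      λ (t∈T , t∈p) → T∉pairs i j (proj₂ (∈-if⁻ _ t∈T)) t∈p)
    λ i j → All.++⁺ (all-if _ (refl , refl)) (all-grid n λ u v →
      (refl , refl) ∷ (refl , refl) ∷ All.++⁺ (all-if _ (refl , refl))
        (all-concatMap (downFrom n) λ x → (refl , refl) ∷ (refl , refl) ∷ []))
    where
    -- Recovers the free parameter `x`: it is the last coordinate of `p₁` in H and the last but one
    -- of `p₂` in V.
    wireKey : Triple → ℕ
    wireKey ((1 , _ , _ , _ , v) , _) = v
    wireKey ((_ , _ , _ , u , _) , _) = u

    T∉pairs : ∀ i j {t} → t ≡ setT i j → t ∉ grid n (pairSets adj K n i j)
    T∉pairs i j {t} refl t∈ with u , v , u< , v< , t∈′ ← ∈-grid⁻ n (pairSets adj K n i j) t∈ =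
      All.lookup {P = _≢ setT i j} ((λ ()) ∷ (λ ()) ∷ All.++⁺ (all-if (allowed adj i j u v) λ ())
        (all-concatMap (downFrom n) λ x → (λ ()) ∷ (λ ()) ∷ [])) t∈′ refl

    unique-wires : ∀ i j u v → Unique (concatMap (wires K i j u v) (downFrom n))
    unique-wires i j u v = unique-concatMap-key wireKey (Unique.downFrom⁺ n)
      (λ x → ((λ ()) ∷ []) ∷ [] ∷ []) λ x → refl ∷ refl ∷ []

    unique-pair : ∀ i j u v → Unique (pairSets adj K n i j u v)
    unique-pair i j u v =
      ((λ ()) ∷ All.++⁺ (all-if _ λ ()) (all-concatMap (downFrom n) λ x → (λ ()) ∷ (λ ()) ∷ [])) ∷
      All.++⁺ (all-if _ λ ()) (all-concatMap (downFrom n) λ x → (λ ()) ∷ (λ ()) ∷ []) ∷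
      Unique.++⁺ (unique-if _) (unique-wires i j u v) λ (t∈E , t∈w) →
        All.lookup {P = _≢ setE i j u v} (all-concatMap (downFrom n) λ x → (λ ()) ∷ (λ ()) ∷ []) t∈w
          (proj₂ (∈-if⁻ _ t∈E))

  increasing : ∀ {t} → IsSet t → Increasing t
  increasing (isT _ _ _) = m≤m+n _ _ , m≤m+n _ _
  increasing (isP _ _ _ _) = m≤m+n _ _ , m≤m+n _ _
  increasing (isQ _ _ _ _) = m≤m+n _ _ , m≤m+n _ _
  increasing (isE _ _ _ _ _) = m≤m+n _ _ , m≤m+n _ _
  increasing (isH _ _ _ _ _) = m≤m+n _ _ , m≤m+n _ _
  increasing (isV _ _ _ _ _) = m≤m+n _ _ , m≤m+n _ _

  elems-valid : ∀ {t x} → IsSet t → x ∈ elems t → IsElem x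
  elems-valid (isT i< j< _) (here refl) = isᵉ i< j<
  elems-valid (isT i< j< _) (there (here refl)) = isʰ i< j<
  elems-valid (isT i< j< _) (there (there (here refl))) = isᵛ i< j<
  elems-valid (isP i< j< u< v<) (here refl) = isp₀ i< j< u< v<
  elems-valid (isP i< j< u< v<) (there (here refl)) = isp₁ i< j< u< v<
  elems-valid (isP i< j< u< v<) (there (there (here refl))) = isp₂ i< j< u< v<
  elems-valid (isQ i< j< u< v<) (here refl) = isq₀ i< j< u< v<
  elems-valid (isQ i< j< u< v<) (there (here refl)) = isq₁ i< j< u< v<
  elems-valid (isQ i< j< u< v<) (there (there (here refl))) = isq₂ i< j< u< v<
  elems-valid (isE i< j< u< v< _) (here refl) = isp₀ i< j< u< v<
  elems-valid (isE i< j< u< v< _) (there (here refl)) = isq₀ i< j< u< v<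
  elems-valid (isE i< j< u< v< _) (there (there (here refl))) = isᵉ i< j<
  elems-valid (isH i< j< u< v< x<) (here refl) = isp₁ i< (next< j<) u< x<
  elems-valid (isH i< j< u< v< x<) (there (here refl)) = isq₁ i< j< u< v<
  elems-valid (isH i< j< u< v< x<) (there (there (here refl))) = isʰ i< j<
  elems-valid (isV i< j< u< v< x<) (here refl) = isp₂ (next< i<) j< x< v<
  elems-valid (isV i< j< u< v< x<) (there (here refl)) = isq₂ i< j< u< v<
  elems-valid (isV i< j< u< v< x<) (there (there (here refl))) = isᵛ i< j<

  wellFormed : WellFormed U F
  wellFormed = record
    { us-unique = unique-U ; ts-unique = unique-F ; increasing = increasing ∘ F⁻
    ; ts⊆us = λ t∈ x∈ → U⁺ (elems-valid (F⁻ t∈) x∈) }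

module _ (adj : ℕ → ℕ → Bool) (K n : ℕ) where
  open Grid adj K n

  ≡ᵇ-refl : ∀ m → (m ≡ᵇ m) ≡ true
  ≡ᵇ-refl m = Equivalence.to T-≡ (≡⇒≡ᵇ m m refl)

  allowed-diag : ∀ {i u v} → T (allowed adj i i u v) → u ≡ v
  allowed-diag {i} {u} {v} ok rewrite ≡ᵇ-refl i = ≡ᵇ⇒≡ u v ok

  allowed-off : ∀ {i j u v} → i ≢ j → T (allowed adj i j u v) → T (adj u v)
  allowed-off {i} {j} i≢j ok with i ≡ᵇ j in eq
  ... | true  = contradiction (≡ᵇ⇒≡ i j (Equivalence.from T-≡ eq)) i≢j
  ... | false = ok

  -- From a perfect packing to pairwise adjacent vertices

  module Soundness (C : Triple → Set)
    (C⊆F : ∀ {t} → C t → IsSet t)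
    (disj : ∀ {s t x} → C s → C t → x ∈ elems s → x ∈ elems t → s ≡ t)
    (cover : ∀ {x} → IsElem x → ∃[ t ] (C t × x ∈ elems t))
    (0<K : 0 < K)
    where

    Active : ℕ → ℕ → ℕ → ℕ → Set
    Active i j u v = C (setE i j u v)

    active-unique : ∀ {i j u v u′ v′} → Active i j u v → Active i j u′ v′ → u ≡ u′ × v ≡ v′
    active-unique a b with disj a b (there (there (here refl))) (there (there (here refl)))
    ... | refl = refl , refl

    start : ∃[ u ] ∃[ v ] Active 0 0 u v
    start with cover (isᵉ 0<K 0<K)
    ... | t , c , x∈ with C⊆F c | x∈
    ...   | isT _ _ ≢00   | here refl = contradiction (refl , refl) ≢00
    ...   | isE _ _ _ _ _ | there (there (here refl)) = _ , _ , c
    ...   | isT _ _ _ | there (there (here ()))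
    ...   | isP _ _ _ _ | there (there (here ()))
    ...   | isQ _ _ _ _ | there (there (here ()))
    ...   | isH _ _ _ _ _ | there (there (here ()))
    ...   | isV _ _ _ _ _ | there (there (here ()))

    right : ∀ {i j u v} → Active i j u v → ∃[ x ] Active i (next K j) u x
    right {i} {j} {u} {v} a with C⊆F a
    ... | isE i< j< u< v< _ with cover (isq₁ i< j< u< v<)
    ...   | t , c , x∈ with C⊆F c | x∈
    ...     | isT _ _ _ | there (there (here ()))
    ...     | isP _ _ _ _ | there (there (here ()))
    ...     | isQ _ _ _ _ | there (there (here ()))
    ...     | isE _ _ _ _ _ | there (there (here ()))
    ...     | isH _ _ _ _ _ | there (there (here ()))
    ...     | isV _ _ _ _ _ | there (there (here ()))
    -- Q is impossible because it shares `q₀` with the active E.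
    ...     | isQ _ _ _ _ | there (here refl) with () ← disj a c (there (here refl)) (here refl)
    -- H has used `p₁` of the pair `(u , x)` in the right neighbour. The port `p₀` of that pair lies
    -- only in P, which would meet H in `p₁`, and in E.
    ...     | isH {x = x} _ _ _ _ x< | there (here refl) with cover (isp₀ i< (next< j<) u< x<)
    ...       | s , d , y∈ with C⊆F d | y∈
    ...         | isT _ _ _ | there (there (here ()))
    ...         | isP _ _ _ _ | there (there (here ()))
    ...         | isQ _ _ _ _ | there (there (here ()))
    ...         | isE _ _ _ _ _ | there (there (here ()))
    ...         | isH _ _ _ _ _ | there (there (here ()))
    ...         | isV _ _ _ _ _ | there (there (here ()))
    ...         | isE _ _ _ _ _ | here refl = x , d
    ...         | isP _ _ _ _ | here refl with () ← disj c d (here refl) (there (here refl))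

    down : ∀ {i j u v} → Active i j u v → ∃[ x ] Active (next K i) j x v
    down {i} {j} {u} {v} a with C⊆F a
    ... | isE i< j< u< v< _ with cover (isq₂ i< j< u< v<)
    ...   | t , c , x∈ with C⊆F c | x∈
    ...     | isT _ _ _ | there (there (here ()))
    ...     | isP _ _ _ _ | there (there (here ()))
    ...     | isE _ _ _ _ _ | there (there (here ()))
    ...     | isH _ _ _ _ _ | there (there (here ()))
    ...     | isV _ _ _ _ _ | there (there (here ()))
    ...     | isQ _ _ _ _ | there (there (here refl)) with () ← disj a c (there (here refl)) (here refl)
    -- As for `right`, with `p₂` as the element in which P would meet V.
    ...     | isV {x = x} _ _ _ _ x< | there (here refl) with cover (isp₀ (next< i<) j< x< v<)
    ...       | s , d , y∈ with C⊆F d | y∈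
    ...         | isT _ _ _ | there (there (here ()))
    ...         | isP _ _ _ _ | there (there (here ()))
    ...         | isQ _ _ _ _ | there (there (here ()))
    ...         | isE _ _ _ _ _ | there (there (here ()))
    ...         | isH _ _ _ _ _ | there (there (here ()))
    ...         | isV _ _ _ _ _ | there (there (here ()))
    ...         | isE _ _ _ _ _ | here refl = x , d
    ...         | isP _ _ _ _ | here refl with () ← disj c d (here refl) (there (there (here refl)))

    row : ∀ {i u v} → Active i 0 u v → ∀ j → j < K → ∃[ x ] Active i j u x
    row a zero    _   = _ , a
    row {i} {u} a (suc j) j<K with x , b ← right (proj₂ (row a j (<⇒≤ j<K))) =
      x , subst (λ k → Active i k u x) (next-suc j<K) b

    column : ∀ {j u v} → Active 0 j u v → ∀ i → i < K → ∃[ x ] Active i j x v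
    column a zero    _   = _ , a
    column {j} {v = v} a (suc i) i<K with x , b ← down (proj₂ (column a i (<⇒≤ i<K))) =
      x , subst (λ k → Active k j x v) (next-suc i<K) b

    -- From the active cell `(0 , 0)` walk down column 0 to row `i`, then to the right; the latter
    -- walk keeps `u`.
    rowValue : ∀ i → i < K → ∃[ u ] (∀ j → j < K → ∃[ x ] Active i j u x)
    rowValue i i<K = let _ , _ , a = start ; u , b = column a i i<K in u , row b

    vertex : Fin K → ℕ
    vertex i = proj₁ (rowValue (toℕ i) (Fin.toℕ<n i))

    -- A second walk goes along row 0 to column `j` and then down, keeping `v`. Both walks reach the
    -- cell, and as a cell has only one active pair, the pair found there combines the row's `u`
    -- with the column's `v`.
    columnValue : ∀ j → ∃[ v ] (∀ i → Active (toℕ i) (toℕ j) (vertex i) v)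
    columnValue j = v , λ i →
        let x , c = proj₂ (rowValue (toℕ i) (Fin.toℕ<n i)) (toℕ j) (Fin.toℕ<n j)
            y , d = column b (toℕ i) (Fin.toℕ<n i)
        in subst (Active (toℕ i) (toℕ j) (vertex i)) (proj₂ (active-unique c d)) c
      where
      first = proj₂ (rowValue 0 0<K) (toℕ j) (Fin.toℕ<n j)
      v = proj₁ first
      b = proj₂ first

    permitted : ∀ {i j u v} → Active i j u v → T (allowed adj i j u v)
    permitted a with C⊆F a
    ... | isE _ _ _ _ ok = ok

    -- The diagonal cell of `j` allows only equal coordinates, so the value of column `j` is the
    -- value of row `j`.
    active-vertices : ∀ i j → Active (toℕ i) (toℕ j) (vertex i) (vertex j)
    active-vertices i j = let v , a = columnValue j in
      subst (Active (toℕ i) (toℕ j) (vertex i)) (sym (allowed-diag {toℕ j} (permitted (a j)))) (a i)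

    vertex< : ∀ i → vertex i < n
    vertex< i with C⊆F (active-vertices i i)
    ... | isE _ _ u< _ _ = u<

    vertex-adj : ∀ {i j} → i ≢ j → T (adj (vertex i) (vertex j))
    vertex-adj {i} {j} i≢j = allowed-off (i≢j ∘ Fin.toℕ-injective) (permitted (active-vertices i j))

  -- The default packing

  own₀ : Elem → Triple
  own₀ (0 , i , j , u , v) = setP i j u v
  own₀ (1 , i , j , u , v) = setP i j u v
  own₀ (2 , i , j , u , v) = setP i j u v
  own₀ (3 , i , j , u , v) = setQ i j u v
  own₀ (4 , i , j , u , v) = setQ i j u v
  own₀ (5 , i , j , u , v) = setQ i j u v
  -- Serves the tags 6 to 8. At cell `(0 , 0)` it names a triple outside the family, which is how
  -- uncovered elements are recognized.
  own₀ (_ , i , j , _ , _) = setT i j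

  own₀-≡ : ∀ {t x} → IsSet t → T (isDefault t) → x ∈ elems t → own₀ x ≡ t
  own₀-≡ (isT _ _ _)   _ (here refl) = refl
  own₀-≡ (isT _ _ _)   _ (there (here refl)) = refl
  own₀-≡ (isT _ _ _)   _ (there (there (here refl))) = refl
  own₀-≡ (isP _ _ _ _) _ (here refl) = refl
  own₀-≡ (isP _ _ _ _) _ (there (here refl)) = refl
  own₀-≡ (isP _ _ _ _) _ (there (there (here refl))) = refl
  own₀-≡ (isQ _ _ _ _) _ (here refl) = refl
  own₀-≡ (isQ _ _ _ _) _ (there (here refl)) = refl
  own₀-≡ (isQ _ _ _ _) _ (there (there (here refl))) = refl

  -- The elements of the omitted set `setT 0 0`. They are exactly what the default packing leaves
  -- uncovered, so it falls one set short of a perfect packing.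
  corner : List Elem
  corner = tᵉ 0 0 ∷ tʰ 0 0 ∷ tᵛ 0 0 ∷ []

  unique-corner : Unique corner
  unique-corner = ((λ ()) ∷ (λ ()) ∷ []) ∷ ((λ ()) ∷ []) ∷ [] ∷ []

  corner⊆U : 0 < K → ∀ {x} → x ∈ corner → IsElem x
  corner⊆U 0<K (here refl) = isᵉ 0<K 0<K
  corner⊆U 0<K (there (here refl)) = isʰ 0<K 0<K
  corner⊆U 0<K (there (there (here refl))) = isᵛ 0<K 0<K

  default-avoids : ∀ {t x} → IsSet t → T (isDefault t) → x ∈ elems t → x ∉ corner
  default-avoids s d x∈ x∈corner with trans (sym (own₀-≡ s d x∈)) (own₀-corner x∈corner)
    where
    own₀-corner : ∀ {x} → x ∈ corner → own₀ x ≡ setT 0 0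
    own₀-corner (here refl) = refl
    own₀-corner (there (here refl)) = refl
    own₀-corner (there (there (here refl))) = refl
  default-avoids (isT _ _ ≢00) d x∈ x∈corner | refl = ≢00 (refl , refl)

  T-covers : ∀ {i j x} → i < K → j < K → x ∈ elems (setT i j) → own₀ x ≡ setT i j →
             x ∈ corner ⊎ (IsSet (own₀ x) × T (isDefault (own₀ x)) × x ∈ elems (own₀ x))
  T-covers {i} {j} i< j< x∈ eq with i ≟ 0 | j ≟ 0
  ... | yes refl | yes refl = inj₁ x∈
  ... | no i≢0   | _ rewrite eq = inj₂ (isT i< j< (i≢0 ∘ proj₁) , _ , x∈)
  ... | yes refl | no j≢0 rewrite eq = inj₂ (isT i< j< (j≢0 ∘ proj₂) , _ , x∈)

  own₀-covers : ∀ {x} → IsElem x → x ∈ corner ⊎ (IsSet (own₀ x) × T (isDefault (own₀ x)) × x ∈ elems (own₀ x))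
  own₀-covers (isᵉ i< j<) = T-covers i< j< (here refl) refl
  own₀-covers (isʰ i< j<) = T-covers i< j< (there (here refl)) refl
  own₀-covers (isᵛ i< j<) = T-covers i< j< (there (there (here refl))) refl
  own₀-covers (isp₀ i< j< u< v<) = inj₂ (isP i< j< u< v< , _ , here refl)
  own₀-covers (isp₁ i< j< u< v<) = inj₂ (isP i< j< u< v< , _ , there (here refl))
  own₀-covers (isp₂ i< j< u< v<) = inj₂ (isP i< j< u< v< , _ , there (there (here refl)))
  own₀-covers (isq₀ i< j< u< v<) = inj₂ (isQ i< j< u< v< , _ , here refl)
  own₀-covers (isq₁ i< j< u< v<) = inj₂ (isQ i< j< u< v< , _ , there (here refl))
  own₀-covers (isq₂ i< j< u< v<) = inj₂ (isQ i< j< u< v< , _ , there (there (here refl)))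

  -- From a clique to a perfect packing

  module Completeness (r : ℕ → ℕ) (r< : ∀ {i} → i < K → r i < n)
    (r-adj : ∀ {i j} → i < K → j < K → i ≢ j → T (adj (r i) (r j)))
    where

    sel : ℕ → ℕ → ℕ → ℕ → Bool
    sel i j u v = (u ≡ᵇ r i) ∧ (v ≡ᵇ r j)

    -- The free parameter is the choice of the neighbour, so H and V use up precisely the ports `p₁`
    -- and `p₂` of the pair selected there.
    E H V : ℕ → ℕ → Triple
    E i j = setE i j (r i) (r j)
    H i j = setH K i j (r i) (r j) (r (next K j))
    V i j = setV K i j (r i) (r j) (r (next K i))

    -- The member of the new packing containing a given element.
    own₁ : Elem → Triple
    own₁ (0 , i , j , u , v) = if sel i j u v then E i j else setP i j u v
    own₁ (1 , i , j , u , v) = if sel i j u v then H i (prev K j) else setP i j u v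
    own₁ (2 , i , j , u , v) = if sel i j u v then V (prev K i) j else setP i j u v
    own₁ (3 , i , j , u , v) = if sel i j u v then E i j else setQ i j u v
    own₁ (4 , i , j , u , v) = if sel i j u v then H i j else setQ i j u v
    own₁ (5 , i , j , u , v) = if sel i j u v then V i j else setQ i j u v
    own₁ (6 , i , j , _ , _) = E i j
    own₁ (7 , i , j , _ , _) = H i j
    own₁ (_ , i , j , _ , _) = V i j

    sel-r : ∀ i j → sel i j (r i) (r j) ≡ true
    sel-r i j rewrite ≡ᵇ-refl (r i) | ≡ᵇ-refl (r j) = refl

    sel-≡ : ∀ i j u v → sel i j u v ≡ true → u ≡ r i × v ≡ r j
    sel-≡ i j u v eq = let a , b = Equivalence.to (T-∧ {u ≡ᵇ r i}) (Equivalence.from T-≡ eq) in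
      ≡ᵇ⇒≡ u (r i) a , ≡ᵇ⇒≡ v (r j) b

    if-true : ∀ {A : Set} {b} {x y : A} → b ≡ true → (if b then x else y) ≡ x
    if-true refl = refl

    if-false : ∀ {A : Set} {b} {x y : A} → b ≡ false → (if b then x else y) ≡ y
    if-false refl = refl

    -- Testing the first element is enough: `own₁-consistent` shows that the other two elements then
    -- have the same owner.
    inF₁ : Triple → Bool
    inF₁ t@(a , _) = isYes (own₁ a ≟ₜ t)

    E-own : ∀ {i j x} → x ∈ elems (E i j) → own₁ x ≡ E i j
    E-own {i} {j} (here refl) = if-true (sel-r i j)
    E-own {i} {j} (there (here refl)) = if-true (sel-r i j)
    E-own (there (there (here refl))) = refl

    H-own : ∀ {i j x} → j < K → x ∈ elems (H i j) → own₁ x ≡ H i j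
    H-own {i} {j} j< (here refl) = trans (if-true (sel-r i (next K j))) (cong (H i) (prev-next j<))
    H-own {i} {j} j< (there (here refl)) = if-true (sel-r i j)
    H-own j< (there (there (here refl))) = refl

    V-own : ∀ {i j x} → i < K → x ∈ elems (V i j) → own₁ x ≡ V i j
    V-own {i} {j} i< (here refl) = trans (if-true (sel-r (next K i) j)) (cong (λ k → V k j) (prev-next i<))
    V-own {i} {j} i< (there (here refl)) = if-true (sel-r i j)
    V-own i< (there (there (here refl))) = refl

    P-own : ∀ {i j u v x} → sel i j u v ≡ false → x ∈ elems (setP i j u v) → own₁ x ≡ setP i j u v
    P-own s (here refl) = if-false s
    P-own s (there (here refl)) = if-false s
    P-own s (there (there (here refl))) = if-false s

    Q-own : ∀ {i j u v x} → sel i j u v ≡ false → x ∈ elems (setQ i j u v) → own₁ x ≡ setQ i j u v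
    Q-own s (here refl) = if-false s
    Q-own s (there (here refl)) = if-false s
    Q-own s (there (there (here refl))) = if-false s

    own₁-consistent : ∀ {t} → IsSet t → own₁ (proj₁ t) ≡ t → ∀ {x} → x ∈ elems t → own₁ x ≡ t
    own₁-consistent (isT _ _ _) ()
    own₁-consistent (isP {i} {j} {u} {v} _ _ _ _) eq with sel i j u v in s
    ... | false = P-own s
    own₁-consistent (isP {i} {j} {u} {v} _ _ _ _) () | true
    own₁-consistent (isQ {i} {j} {u} {v} _ _ _ _) eq with sel i j u v in s
    ... | false = Q-own s
    own₁-consistent (isQ {i} {j} {u} {v} _ _ _ _) () | true
    own₁-consistent (isE {i} {j} {u} {v} _ _ _ _ _) eq with sel i j u v in s
    own₁-consistent (isE {i} {j} {u} {v} _ _ _ _ _) () | false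
    ... | true with refl , refl ← sel-≡ i j u v s = E-own
    own₁-consistent (isH {i} {j} {u} {v} {x} _ j< _ _ _) eq with sel i (next K j) u x in s
    own₁-consistent (isH {i} {j} {u} {v} {x} _ j< _ _ _) () | false
    -- The first element lies in the right neighbour, so its owner is found one cell back, at `j`
    -- again. The equation `eq` then fixes all of `u`, `v` and `x`.
    ... | true rewrite prev-next j< with refl ← eq = H-own j<
    own₁-consistent (isV {i} {j} {u} {v} {x} i< _ _ _ _) eq with sel (next K i) j x v in s
    own₁-consistent (isV {i} {j} {u} {v} {x} i< _ _ _ _) () | false
    ... | true rewrite prev-next i< with refl ← eq = V-own i<

    own₁-≡ : ∀ {t x} → IsSet t → T (inF₁ t) → x ∈ elems t → own₁ x ≡ t
    own₁-≡ {t} s χ = own₁-consistent s (toWitness {a? = own₁ (proj₁ t) ≟ₜ t} χ)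

    isE-r : ∀ {i j} → i < K → j < K → IsSet (E i j)
    isE-r {i} {j} i< j< = isE i< j< (r< i<) (r< j<) ok
      where
      ok : T (allowed adj i j (r i) (r j))
      ok with i ≡ᵇ j in eq
      ... | true with refl ← ≡ᵇ⇒≡ i j (Equivalence.from T-≡ eq) = ≡⇒≡ᵇ (r i) (r i) refl
      ... | false = r-adj i< j< λ { refl → subst T eq (≡⇒≡ᵇ i i refl) }

    isH-r : ∀ {i j} → i < K → j < K → IsSet (H i j)
    isH-r i< j< = isH i< j< (r< i<) (r< j<) (r< (next< j<))

    isV-r : ∀ {i j} → i < K → j < K → IsSet (V i j)
    isV-r i< j< = isV i< j< (r< i<) (r< j<) (r< (next< i<))

    Owned : Elem → Triple → Set
    Owned x t = IsSet t × T (inF₁ t) × x ∈ elems t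

    inF₁⁺ : ∀ {t} → own₁ (proj₁ t) ≡ t → T (inF₁ t)
    inF₁⁺ {t} eq = fromWitness {a? = own₁ (proj₁ t) ≟ₜ t} eq

    E-owned : ∀ {i j x} → i < K → j < K → x ∈ elems (E i j) → Owned x (E i j)
    E-owned i< j< x∈ = isE-r i< j< , inF₁⁺ (E-own (here refl)) , x∈

    H-owned : ∀ {i j x} → i < K → j < K → x ∈ elems (H i j) → Owned x (H i j)
    H-owned i< j< x∈ = isH-r i< j< , inF₁⁺ (H-own j< (here refl)) , x∈

    V-owned : ∀ {i j x} → i < K → j < K → x ∈ elems (V i j) → Owned x (V i j)
    V-owned i< j< x∈ = isV-r i< j< , inF₁⁺ (V-own i< (here refl)) , x∈

    own₁-covers : ∀ {x} → IsElem x → Owned x (own₁ x)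
    own₁-covers (isᵉ i< j<) = E-owned i< j< (there (there (here refl)))
    own₁-covers (isʰ i< j<) = H-owned i< j< (there (there (here refl)))
    own₁-covers (isᵛ i< j<) = V-owned i< j< (there (there (here refl)))
    own₁-covers (isp₀ {i} {j} {u} {v} i< j< u< v<) with sel i j u v in s
    ... | true with refl , refl ← sel-≡ i j u v s = E-owned i< j< (here refl)
    ... | false = isP i< j< u< v< , inF₁⁺ (P-own s (here refl)) , here refl
    own₁-covers (isp₁ {i} {j} {u} {v} i< j< u< v<) with sel i j u v in s
    ... | true with refl , refl ← sel-≡ i j u v s = H-owned i< (prev< j<)
            (here (cong (λ k → p₁ i k (r i) (r k)) (sym (next-prev j<))))
    ... | false = isP i< j< u< v< , inF₁⁺ (P-own s (here refl)) , there (here refl)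
    own₁-covers (isp₂ {i} {j} {u} {v} i< j< u< v<) with sel i j u v in s
    ... | true with refl , refl ← sel-≡ i j u v s = V-owned (prev< i<) j<
            (here (cong (λ k → p₂ k j (r k) (r j)) (sym (next-prev i<))))
    ... | false = isP i< j< u< v< , inF₁⁺ (P-own s (here refl)) , there (there (here refl))
    own₁-covers (isq₀ {i} {j} {u} {v} i< j< u< v<) with sel i j u v in s
    ... | true with refl , refl ← sel-≡ i j u v s = E-owned i< j< (there (here refl))
    ... | false = isQ i< j< u< v< , inF₁⁺ (Q-own s (here refl)) , here refl
    own₁-covers (isq₁ {i} {j} {u} {v} i< j< u< v<) with sel i j u v in s
    ... | true with refl , refl ← sel-≡ i j u v s = H-owned i< j< (there (here refl))
    ... | false = isQ i< j< u< v< , inF₁⁺ (Q-own s (here refl)) , there (here refl)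
    own₁-covers (isq₂ {i} {j} {u} {v} i< j< u< v<) with sel i j u v in s
    ... | true with refl , refl ← sel-≡ i j u v s = V-owned i< j< (there (here refl))
    ... | false = isQ i< j< u< v< , inF₁⁺ (Q-own s (here refl)) , there (there (here refl))

    newSets : List Triple
    newSets = grid K (λ i j → E i j ∷ H i j ∷ V i j ∷ [])

    length-newSets : length newSets ≡ K * (K * 3)
    length-newSets = trans (length-concatMap (K * 3) (downFrom K) λ i →
        trans (length-concatMap 3 (downFrom K) λ j → refl) (cong (_* 3) (length-downFrom K)))
      (cong (_* (K * 3)) (length-downFrom K))

    -- The third element of E, H or V is a cell element, whose owner depends only on the cell. This
    -- leaves one set of each kind per cell.
    newSets-complete : ∀ {t} → IsSet t → T (inF₁ t) → ¬ T (isDefault t) → t ∈ newSets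
    newSets-complete (isT _ _ _)   _ ¬d = contradiction _ ¬d
    newSets-complete (isP _ _ _ _) _ ¬d = contradiction _ ¬d
    newSets-complete (isQ _ _ _ _) _ ¬d = contradiction _ ¬d
    newSets-complete s@(isE i< j< _ _ _) χ _ = subst (_∈ newSets) (own₁-≡ s χ (there (there (here refl))))
      (∈-grid⁺ i< j< (here refl))
    newSets-complete s@(isH i< j< _ _ _) χ _ = subst (_∈ newSets) (own₁-≡ s χ (there (there (here refl))))
      (∈-grid⁺ i< j< (there (here refl)))
    newSets-complete s@(isV i< j< _ _ _) χ _ = subst (_∈ newSets) (own₁-≡ s χ (there (there (here refl))))
      (∈-grid⁺ i< j< (there (there (here refl))))

-- Encodings

bits : ℕᵇ → List Bool
bits zero     = []
bits 2[1+ b ] = false ∷ bits b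
bits 1+[2 b ] = true ∷ bits b

enc-bits : ∀ b → encList encBool (bits b) ≡ encℕᵇ b
enc-bits zero     = refl
enc-bits 2[1+ b ] = cong (node _) (enc-bits b)
enc-bits 1+[2 b ] = cong (node _) (enc-bits b)

bits-injective : ∀ {b c} → bits b ≡ bits c → b ≡ c
bits-injective {zero}     {zero}     eq = refl
bits-injective {2[1+ b ]} {2[1+ c ]} eq = cong 2[1+_] (bits-injective (cong tail eq))
bits-injective {1+[2 b ]} {1+[2 c ]} eq = cong 1+[2_] (bits-injective (cong tail eq))

-- Capping at every digit agrees with capping once at the end: as soon as `x` reaches `c`, both
-- sides equal `c`.
⊓-absorb : ∀ c x d → c ⊓ ((c ⊓ x) + ((c ⊓ x) + d)) ≡ c ⊓ (x + (x + d))
⊓-absorb c x d with ≤-total c x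
... | inj₁ c≤x rewrite m≤n⇒m⊓n≡m c≤x =
  trans (m≤n⇒m⊓n≡m (m≤m+n c _)) (sym (m≤n⇒m⊓n≡m (≤-trans c≤x (m≤m+n x _))))
... | inj₂ x≤c rewrite m≥n⇒m⊓n≡n x≤c = refl

cappedValue-bits : ∀ c b → cappedValue c (bits b) ≡ c ⊓ valᵇ b
cappedValue-bits c b = trans (reverse-foldl _ 0 (bits b)) (go b)
  where
  step : Bool → ℕ → ℕ
  step d acc = c ⊓ (acc + (acc + (if d then 1 else 2)))

  go : ∀ b → foldr step 0 (bits b) ≡ c ⊓ valᵇ b
  go zero     = sym (⊓-zeroʳ c)
  go 2[1+ b ] rewrite go b = trans (⊓-absorb c (valᵇ b) 2) (cong (c ⊓_)
    (solve 1 (λ x → x :+ (x :+ :con 2) := :con 2 :* (:con 1 :+ x)) refl (valᵇ b)))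
  go 1+[2 b ] rewrite go b = trans (⊓-absorb c (valᵇ b) 1) (cong (c ⊓_)
    (solve 1 (λ x → x :+ (x :+ :con 1) := :con 1 :+ :con 2 :* x) refl (valᵇ b)))

eqBits-refl : ∀ xs → T (eqBits xs xs)
eqBits-refl []           = _
eqBits-refl (true  ∷ xs) = eqBits-refl xs
eqBits-refl (false ∷ xs) = eqBits-refl xs

eqBits-sound : ∀ xs ys → T (eqBits xs ys) → xs ≡ ys
eqBits-sound []           []           _ = refl
eqBits-sound (true  ∷ xs) (true  ∷ ys) p = cong (true ∷_) (eqBits-sound xs ys p)
eqBits-sound (false ∷ xs) (false ∷ ys) p = cong (false ∷_) (eqBits-sound xs ys p)

nth-map-tabulate : ∀ (d : B) (f : A → B) {n} (g : Fin n → A) i →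
                   nth d (map f (toList (tabulate g))) (toℕ i) ≡ f (g i)
nth-map-tabulate d f g zero    = refl
nth-map-tabulate d f g (suc i) = nth-map-tabulate d f (g ∘ suc) i

nth-tabulate : ∀ (d : A) {n} (g : Fin n → A) i → nth d (toList (tabulate g)) (toℕ i) ≡ g i
nth-tabulate d g zero    = refl
nth-tabulate d g (suc i) = nth-tabulate d (g ∘ suc) i

encList-map : ∀ (e : B → Tree) (f : A → B) xs → encList e (map f xs) ≡ encList (e ∘ f) xs
encList-map e f []       = refl
encList-map e f (x ∷ xs) = cong (node _) (encList-map e f xs)

encList-cong : ∀ {e e′ : A → Tree} → (∀ x → e x ≡ e′ x) → ∀ xs → encList e xs ≡ encList e′ xs
encList-cong eq []       = refl
encList-cong eq (x ∷ xs) = cong₂ node (eq x) (encList-cong eq xs)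

toList-tabulate-lookup : ∀ (f : A → B) xs → toList (tabulate (f ∘ lookup xs)) ≡ map f xs
toList-tabulate-lookup f []       = refl
toList-tabulate-lookup f (x ∷ xs) = cong (f x ∷_) (toList-tabulate-lookup f xs)

enc-system : ∀ us ts → enc rawOutput (tables us ts) ≡ encSetSystem (system us ts)
enc-system us ts = cong₂ (λ x y → node (encUnary (length us)) (node x y))
  (sym (trans (cong (encList (encVec encBool)) (toList-tabulate-lookup charVec ts))
    (trans (encList-map (encVec encBool) charVec ts)
      (trans (encList-cong (λ t → cong (encList encBool) (toList-tabulate-lookup (λ x → mem x t) us)) ts)
        (sym (encList-map (encList encBool) (λ t → map (λ x → mem x t) us) ts))))))
  (cong (encList encBool) (sym (toList-tabulate-lookup isDefault ts)))
  where
  charVec : Triple → Subset (length us)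
  charVec t = tabulate λ x → mem (lookup us x) t

p─q⊆∁q : ∀ {n i} (p q : Subset n) → i ∈ₛ p ─ q → i ∉ₛ q
p─q⊆∁q (_ ∷ p) (true  ∷ q) (Vec.there i∈) (Vec.there i∈q) = p─q⊆∁q p q i∈ i∈q
p─q⊆∁q (_ ∷ p) (false ∷ q) (Vec.there i∈) (Vec.there i∈q) = p─q⊆∁q p q i∈ i∈q

-- Passes from typed raw data to arbitrary types: only the trees have to agree. Sizes are positive,
-- so `monomial-bound` applies.
polyTime : ∀ {a b f} {encA : A → Tree} {encB : B → Tree} {R : A → B} → Poly a b f →
           (raw : A → ⟦ a ⟧) → (∀ x → enc a (raw x) ≡ encA x) → (∀ x → enc b (f (raw x)) ≡ encB (R x)) →
           PolyTime encA encB R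
polyTime {a = a} {encA = encA} {encB} {R} P raw enc-raw enc-R =
  let c , d , bound = monomial-bound (Poly.bnd P) in Poly.prog P , c , d , λ x →
    let t , run , t≤ = Poly.run P (raw x)
    in t , subst (λ s → Poly.prog P ⊢ s ⇓ encB (R x) [ t ]) (enc-raw x)
             (subst (λ y → Poly.prog P ⊢ enc a (raw x) ⇓ y [ t ]) (enc-R x) run)
         , ≤-trans t≤ (subst (λ s → eval (Poly.bnd P) s ≤ c * size (encA x) ^ d)
             (sym (cong size (enc-raw x))) (size-bound {c} {d} {Poly.bnd P} (encA x) bound))
  where
  size-bound : ∀ {c d p} s → (∀ m → eval p (suc m) ≤ c * suc m ^ d) → eval p (size s) ≤ c * size s ^ d
  size-bound nil        bound = bound 0
  size-bound (node x y) bound = bound (size x + size y)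

-- The reduction applied to an instance

code : ∀ {m} → Fin m → List Bool
code x = bits (fromℕ (toℕ x))

code-injective : ∀ {m} (x y : Fin m) → code x ≡ code y → x ≡ y
code-injective x y eq = Fin.toℕ-injective (trans (sym (toℕ-fromℕ (toℕ x)))
  (trans (cong valᵇ (bits-injective {fromℕ (toℕ x)} {fromℕ (toℕ y)} eq)) (toℕ-fromℕ (toℕ y))))

T-not : ∀ {b} → T (not b) → ¬ T b
T-not {false} _ ()

module Reduction (I : Instance) where
  open Instance I renaming (sym to adj-sym)

  colors : List (List Bool)
  colors = map code (toList (tabulate color))

  rows : List (List Bool)
  rows = map toList (toList (tabulate λ u → tabulate (adj u)))

  raw : RawInstance
  raw = bits (fromℕ k) , colors , rows

  enc-raw : enc rawInstance raw ≡ encInstance I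
  enc-raw = cong₂ node (enc-bits (fromℕ k)) (cong₂ node
    (trans (encList-map (encList encBool) _ (toList (tabulate color)))
      (encList-cong (λ x → enc-bits (fromℕ (toℕ x))) (toList (tabulate color))))
    (encList-map (encList encBool) toList (toList (tabulate λ u → tabulate (adj u)))))

  K : ℕ
  K = suc n ⊓ k

  compat : ℕ → ℕ → Bool
  compat = rawAdj (colors , rows)

  open Grid compat K n public using (U; F; wellFormed; U⁺; U⁻; F⁺; F⁻; unique-F)

  S : SetSystem
  S = system U F

  length-colors : length colors ≡ n
  length-colors = trans (length-map _ (toList (tabulate color))) (length-toList (tabulate color))

  rawK-≡ : rawK raw ≡ K
  rawK-≡ = trans (cappedValue-bits (suc (length colors)) (fromℕ k))
    (cong₂ (λ m v → suc m ⊓ v) length-colors (toℕ-fromℕ k))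

  enc-S : enc rawOutput (rawReduction raw) ≡ encSetSystem S
  enc-S = trans (cong₂ (λ K n → enc rawOutput (tables (universe K n) (family compat K n))) rawK-≡ length-colors)
    (enc-system U F)

  0<K : 0 < K
  0<K = ⊓-pres-m< (s≤s z≤n) k>0

  compat-≡ : ∀ u v → compat (toℕ u) (toℕ v) ≡ adj u v ∧ not (eqBits (code (color u)) (code (color v)))
  compat-≡ u v
    rewrite nth-map-tabulate [] toList (λ u → tabulate (adj u)) u
          | nth-tabulate false (adj u) v
          | nth-map-tabulate [] code color u
          | nth-map-tabulate [] code color v = refl

  compat⁺ : ∀ {u v} → T (adj u v) → color u ≢ color v → T (compat (toℕ u) (toℕ v))
  compat⁺ {u} {v} a c≢ = subst T (sym (compat-≡ u v)) (Equivalence.from T-∧ (a , differ))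
    where
    differ : T (not (eqBits (code (color u)) (code (color v))))
    differ with eqBits (code (color u)) (code (color v)) in eq
    ... | false = _
    ... | true  = c≢ (code-injective (color u) (color v)
      (eqBits-sound (code (color u)) (code (color v)) (Equivalence.from T-≡ eq)))

  compat⁻ : ∀ {u v} → T (compat (toℕ u) (toℕ v)) → T (adj u v) × color u ≢ color v
  compat⁻ {u} {v} c = let a , d = Equivalence.to (T-∧ {adj u v}) (subst T (compat-≡ u v) c) in
    a , λ eq → T-not d (subst (λ x → T (eqBits (code x) (code (color v)))) (sym eq) (eqBits-refl (code (color v))))

  F₀ : Subset (length F)
  F₀ = SetSystem.𝓕₀ S

  own₀-chosen : ∀ {t x} → t ∈ F → T (isDefault t) → x ∈ elems t → own₀ compat K n x ≡ t
  own₀-chosen = own₀-≡ compat K n ∘ F⁻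

  card-U : length U ≡ suc ∣ F₀ ∣ * 3
  card-U = trans (chosen-card wellFormed isDefault (own₀ compat K n) own₀-chosen
      (corner compat K n) (unique-corner compat K n)
      (U⁺ ∘ corner⊆U compat K n 0<K) (default-avoids compat K n ∘ F⁻)
      λ x∈ → [ inj₁ , (λ (s , d , m) → inj₂ (F⁺ s , d , m)) ]′ (own₀-covers compat K n (U⁻ x∈)))
    (+-comm (∣ F₀ ∣ * 3) 3)

  card₀ : suc ∣ F₀ ∣ ≡ length U / 3
  card₀ = sym (trans (cong (_/ 3) card-U) (m*n/n≡m (suc ∣ F₀ ∣) 3))

  valid : IsValid S
  valid = record
    { no-repetition = 𝓕-injective wellFormed
    ; triples       = 𝓕-triples wellFormed
    ; 3∣m           = divides (suc ∣ F₀ ∣) card-U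
    ; disjoint₀     = chosen-disjoint wellFormed isDefault (own₀ compat K n) own₀-chosen
    ; card₀         = card₀
    }

  module _ {Q : Subset n} (clq : IsMulticoloredClique I Q) where
    open IsMulticoloredClique clq

    -- A clique with `k` vertices forces `k ≤ n`, below the cap `suc n`.
    K≡k : K ≡ k
    K≡k = m≥n⇒m⊓n≡n (m≤n⇒m≤1+n (subst (_≤ n) card (∣p∣≤n Q)))

    vertices : List (Fin n)
    vertices = members Q

    -- Enumerates the clique. The default 0 is never reached at arguments below `K`, since the
    -- clique has `K` members.
    r : ℕ → ℕ
    r = nth 0 (map toℕ vertices)

    pick : ∀ {i} → i < K → ∃[ p ] (toℕ p ≡ i × toℕ (lookup vertices p) ≡ r i)
    pick {i} i< = fromℕ< i<′ , Fin.toℕ-fromℕ< i<′ , sym (nth-map-lookup vertices i<′)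
      where
      i<′ : i < length vertices
      i<′ = subst (i <_) (sym (trans (length-members Q) (trans card (sym K≡k)))) i<
      nth-map-lookup : ∀ (xs : List (Fin n)) {i} (i< : i < length xs) →
                       nth 0 (map toℕ xs) i ≡ toℕ (lookup xs (fromℕ< i<))
      nth-map-lookup (x ∷ xs) {zero}  i<       = refl
      nth-map-lookup (x ∷ xs) {suc i} (s≤s i<) = nth-map-lookup xs i<

    r< : ∀ {i} → i < K → r i < n
    r< i< = let p , _ , eq = pick i< in subst (_< n) eq (Fin.toℕ<n (lookup vertices p))

    r-compat : ∀ {i j} → i < K → j < K → i ≢ j → T (compat (r i) (r j))
    r-compat i< j< i≢j =
      let p , p≡ , p-r = pick i<
          q , q≡ , q-r = pick j<
          neq = λ eq → i≢j (trans (sym p≡) (trans (cong toℕ (lookup-injective (unique-members Q) eq)) q≡))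
          p∈ = ∈-members⁻ Q (∈-lookup p)
          q∈ = ∈-members⁻ Q (∈-lookup q)
      in subst T (cong₂ compat p-r q-r) (compat⁺ (clique p∈ q∈ neq) (distinct p∈ q∈ neq))

    open Completeness compat K n r r< r-compat

    F₁ : Subset (length F)
    F₁ = chosen wellFormed inF₁

    own₁-chosen : ∀ {t x} → t ∈ F → T (inF₁ t) → x ∈ elems t → own₁ x ≡ t
    own₁-chosen = own₁-≡ ∘ F⁻

    card₁ : ∣ F₁ ∣ ≡ length U / 3
    card₁ = sym (trans (cong (_/ 3) (trans (chosen-card wellFormed inF₁ own₁ own₁-chosen
        [] [] (λ ()) (λ _ _ _ ())
        λ x∈ → let s , d , m = own₁-covers (U⁻ x∈) in inj₂ (F⁺ s , d , m))
      (+-identityʳ _))) (m*n/n≡m ∣ F₁ ∣ 3))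

    F₁-perfect : IsPerfectPacking S F₁
    F₁-perfect = chosen-disjoint wellFormed inF₁ own₁ own₁-chosen , card₁

    ∣F₁─F₀∣≤ : ∣ F₁ ─ F₀ ∣ ≤ k * (k * 3)
    ∣F₁─F₀∣≤ = subst (λ m → ∣ F₁ ─ F₀ ∣ ≤ m * (m * 3)) K≡k (subst (∣ F₁ ─ F₀ ∣ ≤_) length-newSets
      (card-≤ unique-F (F₁ ─ F₀) λ {i} i∈ → newSets-complete (F⁻ (∈-lookup i))
        (∈-tabulate⁻ (p─q⊆p F₁ F₀ i∈)) (p─q⊆∁q F₁ F₀ i∈ ∘ ∈-tabulate⁺)))

    -- The default packing is smaller by one set, and both differences are taken against the same
    -- common part.
    ∣F₀─F₁∣≤ : ∣ F₀ ─ F₁ ∣ ≤ ∣ F₁ ─ F₀ ∣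
    ∣F₀─F₁∣≤ = +-cancelʳ-≤ ∣ F₀ ∣ _ _ (≤-trans
      (+-monoʳ-≤ ∣ F₀ ─ F₁ ∣ (≤-trans (n≤1+n _) (≤-reflexive (trans card₀ (sym card₁)))))
      (≤-reflexive (∣p─q∣+∣q∣ F₀ F₁)))

    -- Three new sets in each of `k * k` cells, and no more sets removed than added: this is where
    -- the constant 6 comes from.
    close : ∣ F₀ ─ F₁ ∣ + ∣ F₁ ─ F₀ ∣ ≤ 6 * k ^ 2
    close = ≤-trans (+-mono-≤ (≤-trans ∣F₀─F₁∣≤ ∣F₁─F₀∣≤) ∣F₁─F₀∣≤)
      (≤-reflexive (solve 1 (λ x → x :* (x :* :con 3) :+ x :* (x :* :con 3) := :con 6 :* x :^ 2) refl k))

  module _ {vertex : Fin K → ℕ} (vertex< : ∀ i → vertex i < n)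
           (vertex-adj : ∀ {i j} → i ≢ j → T (compat (vertex i) (vertex j))) where

    f : Fin K → Fin n
    f i = fromℕ< (vertex< i)

    f-adj : ∀ {i j} → i ≢ j → T (adj (f i) (f j)) × color (f i) ≢ color (f j)
    f-adj {i} {j} i≢j = compat⁻ (subst T
      (sym (cong₂ compat (Fin.toℕ-fromℕ< (vertex< i)) (Fin.toℕ-fromℕ< (vertex< j))))
      (vertex-adj i≢j))

    f-injective : Injective _≡_ _≡_ f
    f-injective {i} {j} eq with i Fin.≟ j
    ... | yes i≡j = i≡j
    -- Compatible vertices differ in color and hence cannot coincide.
    ... | no  i≢j = contradiction (cong color eq) (proj₂ (f-adj i≢j))

    -- Were the cap attained with `n < k`, there would be `suc n` distinct vertices among `n`.
    K≡k′ : K ≡ k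
    K≡k′ with ≤-total (suc n) k
    ... | inj₁ n<k = contradiction (subst (_≤ n) (m≤n⇒m⊓n≡m n<k) (Fin.injective⇒≤ f-injective)) 1+n≰n
    ... | inj₂ k≤n = m≥n⇒m⊓n≡n k≤n

    image : Subset n
    image = tabulate λ v → isYes (Fin.any? λ i → f i Fin.≟ v)

    image⁻ : ∀ {v} → v ∈ₛ image → ∃[ i ] f i ≡ v
    image⁻ {v} v∈ = toWitness {a? = Fin.any? λ i → f i Fin.≟ v} (∈-tabulate⁻ v∈)

    image⁺ : ∀ i → f i ∈ₛ image
    image⁺ i = ∈-tabulate⁺ (fromWitness {a? = Fin.any? λ j → f j Fin.≟ f i} (i , refl))

    card-image : ∣ image ∣ ≡ K
    card-image = trans (sym (length-members image)) (trans (≤-antisym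
        (⊆-length (unique-members image) λ v∈ → let i , eq = image⁻ (∈-members⁻ image v∈) in
          subst (_∈ List.tabulate f) eq (∈.∈-tabulate⁺ i))
        (⊆-length (Unique.tabulate⁺ f-injective) λ v∈ → let i , eq = ∈.∈-tabulate⁻ v∈ in
          subst (_∈ members image) (sym eq) (∈-members⁺ (image⁺ i))))
      (length-tabulate f))

    image-adj : ∀ {u v} → u ∈ₛ image → v ∈ₛ image → u ≢ v → T (adj u v) × color u ≢ color v
    image-adj u∈ v∈ u≢v with image⁻ u∈ | image⁻ v∈
    ... | i , refl | j , refl = f-adj (u≢v ∘ cong f)

    vertices⇒yes : Yes I
    vertices⇒yes = image , record
      { card     = trans card-image K≡k′
      ; clique   = λ u∈ v∈ u≢v → proj₁ (image-adj u∈ v∈ u≢v)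
      ; distinct = λ u∈ v∈ u≢v → proj₂ (image-adj u∈ v∈ u≢v)
      }

  module _ {G : Subset (length F)} (perfect : IsPerfectPacking S G) where

    Chosen : Triple → Set
    Chosen t = ∃[ i ] (i ∈ₛ G × lookup F i ≡ t)

    chosen⇒set : ∀ {t} → Chosen t → Grid.IsSet compat K n t
    chosen⇒set (i , _ , refl) = F⁻ (∈-lookup i)

    chosen-≡ : ∀ {s t x} → Chosen s → Chosen t → x ∈ elems s → x ∈ elems t → s ≡ t
    chosen-≡ (i , i∈ , refl) (j , j∈ , refl) x∈s x∈t =
      cong (lookup F) (disjoint⇒≡ wellFormed (proj₁ perfect) i∈ j∈ x∈s x∈t)

    chosen-covers : ∀ {x} → Grid.IsElem compat K n x → ∃[ t ] (Chosen t × x ∈ elems t)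
    chosen-covers x =
      let i , i∈ , x∈ = perfect-covers wellFormed (IsValid.3∣m valid) perfect (U⁺ x)
      in lookup F i , (i , i∈ , refl) , x∈

    module Sound = Soundness compat K n Chosen chosen⇒set chosen-≡ chosen-covers 0<K

    perfect⇒yes : Yes I
    perfect⇒yes = vertices⇒yes Sound.vertex< Sound.vertex-adj

open SetSystem using (𝓕₀)
open Instance using (k)

reduction-polyTime : PolyTime encInstance encSetSystem Reduction.S
reduction-polyTime = polyTime {encA = encInstance} {encSetSystem} {Reduction.S} rawReductionₚ Reduction.raw Reduction.enc-raw Reduction.enc-S

theorem8 : Σ[ α ∈ ℕ ] (α > 0 ×
    (Σ[ R ∈ (Instance → SetSystem) ] (PolyTime encInstance encSetSystem R ×
    (∀ (I : Instance) →
    IsValid (R I) ×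
    (Yes I →
    ∃[ 𝓕₁ ] (IsPerfectPacking (R I) 𝓕₁ ×
    ∣ 𝓕₀ (R I) ─ 𝓕₁ ∣ + ∣ 𝓕₁ ─ 𝓕₀ (R I) ∣ ≤ α * k I ^ 2)) ×
    ((∃[ 𝓕₁ ] IsPerfectPacking (R I) 𝓕₁) → Yes I)))))
theorem8 = 6 , s≤s z≤n , Reduction.S , reduction-polyTime , λ I → let open Reduction I in
  valid ,
  (λ (_ , clq) → F₁ clq , F₁-perfect clq , close clq) ,
  (λ (_ , perfect) → perfect⇒yes perfect)
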